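{- Let $q=p^k$ with $p$ prime and $k\ge1$. The number of equivalence classes, under dynamical equivalence, of the dynamical systems $(\mathbb{F}_q,x\mapsto f(x))$ with $f(X)=aX^p+b$, $a\in\mathbb{F}_q^*$, $b\in\mathbb{F}_q$, is equal to $\tau(p-1)+1$, where $\tau(m)$ is the number of positive divisors of $m$. In particular, exactly one of these equivalence classes consists of systems having no fixed point. Moreover, if such an $f=aX^p+b$ has a fixed point, then it has exactly $p$ fixed points if $\mathrm{Nm}_{\mathbb{F}_q/\mathbb{F}_p}(a)=1$, and otherwise it has exactly one fixed point.
   Context: Two dynamical systems $(\mathbb{S},f)$ and $(\mathbb{T},g)$ (maps $f:\mathbb{S}\to\mathbb{S}$, $g:\mathbb{T}\to\mathbb{T}$) are dynamically equivalent if there is a bijection $\sigma:\mathbb{S}\to\mathbb{T}$ with $\sigma^{ -1}\circ g\circ\sigma=f$. A fixed point of $f$ is $x\in\mathbb{F}_q$ with $f(x)=x$. The norm is $\mathrm{Nm}_{\mathbb{F}_q/\mathbb{F}_p}(x)=x^{1+p+\cdots+p^{k-1}}$. -}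

module Defs where

open import Data.Nat as ℕ using (ℕ; zero; suc)
open import Data.Nat.Divisibility using (_∣?_)
open import Data.Fin using (Fin)
open import Data.List using (List; length; filter; map; upTo)
open import Data.Nat.ListAction using (sum)
open import Data.Product using (Σ; ∃; _×_)
open import Relation.Binary.PropositionalEquality using (_≡_; _≢_)
open import Relation.Nullary using (¬_)
open import Function.Bundles using (_↔_; Inverse; _⇔_)
open import Function.Definitions using (Surjective)
open import Algebra.Structures using (IsCommutativeRing)

τ : ℕ → ℕ
τ m = length (filter (_∣? m) (map suc (upTo m)))

-- Exponent of the norm  Nm_{F_{p^k}/F_p}(x) = x^(1 + p + ⋯ + p^(k-1)).
normExp : ℕ → ℕ → ℕ
normExp p k = sum (map (p ℕ.^_) (upTo k))

record FiniteField (q : ℕ) : Set₁ where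
  infixl 7 _*_
  infixl 6 _+_
  field
    Carrier           : Set
    _+_ _*_           : Carrier → Carrier → Carrier
    -_                : Carrier → Carrier
    0# 1#             : Carrier
    isCommutativeRing : IsCommutativeRing _≡_ _+_ _*_ -_ 0# 1#
    0≢1               : 0# ≢ 1#
    inverse           : ∀ x → x ≢ 0# → ∃ λ y → x * y ≡ 1#
    enumeration       : Fin q ↔ Carrier

  _^_ : Carrier → ℕ → Carrier
  x ^ zero  = 1#
  x ^ suc n = x * (x ^ n)

DynEquiv : {S T : Set} → (S → S) → (T → T) → Set
DynEquiv {S} {T} f g =
  Σ (S ↔ T) λ σ → ∀ x → Inverse.from σ (g (Inverse.to σ x)) ≡ f x

HasNumberOfClasses : {A : Set} → (A → A → Set) → ℕ → Set
HasNumberOfClasses {A} R n =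
  Σ (A → Fin n) λ cls → Surjective _≡_ _≡_ cls × (∀ x y → (cls x ≡ cls y) ⇔ R x y)

HasExactlyFixedPoints : {S : Set} → (S → S) → ℕ → Set
HasExactlyFixedPoints {S} f m = Fin m ↔ Σ S (λ x → f x ≡ x)

HasFixedPoint : {S : Set} → (S → S) → Set
HasFixedPoint {S} f = ∃ λ (x : S) → f x ≡ x

module _ {q : ℕ} (F : FiniteField q) where
  open FiniteField F

  record AffParam : Set where
    constructor param
    field
      a   : Carrier
      a≢0 : a ≢ 0#
      b   : Carrier

  affMap : ℕ → AffParam → Carrier → Carrier
  affMap p P x = AffParam.a P * (x ^ p) + AffParam.b P

  Nm : ℕ → ℕ → Carrier → Carrier
  Nm p k x = x ^ normExp p k

{-# OPTIONS --safe #-}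
module Submission where

-- Write N for the norm. If a x^p + b has a fixed point, translating it to 0 gives the additive map
-- L_a : x ↦ a x^p, whose jk-th iterate is multiplication by N(a)^j; the order of N(a) is therefore
-- an invariant. For a primitive root g it is (p−1)/gcd(i,p−1) when a = g^i. Conversely scaling by v
-- conjugates L_{a v^(p−1)} to L_a, and the bijection x ↦ x^u, for u prime to q − 1, conjugates L_a
-- to L_{a^u}; together they bring L_{g^i} to L_{g^e} with e = gcd(i,p−1), one class per divisor e of
-- p − 1. If there is no fixed point, then x ↦ x − a x^p is not injective, so N(a) = 1, a is a
-- (p−1)-th power and scaling reduces to x^p + b. There Tr b ≠ 0 by the additive Hilbert 90, and any
-- two such maps are conjugate by an affine map x ↦ c x + y with c in the prime field.

open import Defs
open import Algebra.Bundles using (CommutativeRing)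
import Algebra.Properties.Ring as RingProperties
import Algebra.Solver.Ring.NaturalCoefficients.Default as NaturalCoefficients
open import Axiom.UniquenessOfIdentityProofs using (module Decidable⇒UIP)
open import Data.Empty using (⊥; ⊥-elim)
open import Data.Fin.Base using (Fin; zero; suc; toℕ; fromℕ; fromℕ<; inject₁; punchOut; join; splitAt)
import Data.Fin.Properties as Fin
open import Data.List.Base using (List; []; _∷_; applyUpTo; filter; lookup; map; upTo)
open import Data.List.Membership.Propositional using (_∈_)
open import Data.List.Membership.Propositional.Properties using (∈-filter⁺; ∈-filter⁻; ∈-lookup; ∈-map⁺; ∈-upTo⁺)
open import Data.List.Properties using (map-applyUpTo; map-upTo)
import Data.List.Relation.Unary.All as All
open import Data.List.Relation.Unary.All using (_∷_)
open import Data.List.Relation.Unary.AllPairs using (_∷_)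
open import Data.List.Relation.Unary.Any using (index)
open import Data.List.Relation.Unary.Any.Properties using (lookup-index)
open import Data.List.Relation.Unary.Unique.Propositional using (Unique)
import Data.List.Relation.Unary.Unique.Propositional.Properties as Unique
open import Data.Nat.Base as ℕ using (ℕ; zero; suc; NonZero; _∸_; _<_; _≤_; z≤n; s≤s)
open import Data.Nat.Combinatorics using (_C_; k![n∸k]!∣n!; nCk≡n!/k![n-k]!; nCk≡nC[n∸k]; nCn≡1)
open import Data.Nat.Coprimality as Coprimality using (Coprime; coprime-Bézout; coprime-divisor)
open import Data.Nat.Divisibility
open import Data.Nat.DivMod using (_/_; _%_; m≡m%n+[m/n]*n; m%n<n; m/n*n≡m)
open import Data.Nat.GCD using
  (gcd; gcd[m,n]∣m; gcd[m,n]∣n; gcd-greatest; gcd[m,n]≡0⇒m≡0; gcd[m,n]≡0⇒n≡0; module Bézout)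
open import Data.Nat.GeneralisedArithmetic using (fold; fold-+)
open import Data.Nat.Induction using (<-rec)
open import Data.Nat.Primality
open import Data.Nat.Primality.Factorisation using (factorise)
import Data.Nat.Properties as ℕ
open import Data.Product as Product using (∃; ∃₂; _×_; _,_; map₂; proj₁; proj₂)
open import Data.Sum using (_⊎_; inj₁; inj₂; [_,_]′)
open import Function.Base using (_∘_; case_of_)
open import Function.Bundles using (_↔_; Inverse; mk↔ₛ′; mk⇔)
import Function.Construct.Composition as Composition
import Function.Construct.Symmetry as Symmetry
open import Function.Definitions using (Injective; Surjective)
open import Level using (0ℓ)
open import Relation.Binary.Definitions using (DecidableEquality)
open import Relation.Binary.PropositionalEquality
open import Relation.Nullary using (¬_; Dec; yes; no; contradiction)
open import Relation.Nullary.Decidable using (map′; _×-dec_; ¬?; decidable-stable)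
open import Relation.Unary using (Decidable)

-- Conjugacies are arbitrary bijections, so the linear ones do not settle the count. Scaling alone
-- relates L_a to L_a′ exactly when N(a) = N(a′), which leaves p - 1 families. The power maps are
-- multiplicative but not additive; they respect L_a only because it is a monomial, and they merge
-- all norms that generate the same subgroup of the cyclic group of order p - 1. Hence τ(p - 1), the
-- number of these subgroups. The difficulty is that u is prescribed only modulo (p - 1)/e but has
-- to be prime to q - 1, which may have further prime factors. The field is given by its axioms and
-- an enumeration, so counting has to yield the rest: the bound on the roots of a polynomial gives a
-- primitive root and also an element of nonzero trace, and finiteness turns injective maps into
-- bijections. With a = g^i, conditions on norms become divisibilities between exponents.

module NumberTheory where
  open import Data.Nat.Base
  open import Data.Nat.ListAction using (sum)
  open import Data.Nat.Properties

  -- Divisibility, coprime factors and the norm exponent.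

  primeDivisor : ∀ n → .{{NonZero n}} → n ≢ 1 → ∃ λ p → Prime p × p ∣ n
  primeDivisor n n≢1 with factorise n
  ... | record { factors = [] ; isFactorisation = n≡1 } = contradiction n≡1 n≢1
  ... | record { factors = p ∷ ps ; isFactorisation = eq ; factorsPrime = pp ∷ _ } =
    p , pp , subst (p ∣_) (sym eq) (m∣m*n _)

  prime≢1 : ∀ {p} → Prime p → p ≢ 1
  prime≢1 pp refl = contradiction pp ¬prime[1]

  prime∣prime : ∀ {p r} → Prime p → Prime r → p ∣ r → p ≡ r
  prime∣prime pp pr p∣r with prime⇒irreducible pr p∣r
  ... | inj₁ p≡1 = contradiction p≡1 (prime≢1 pp)
  ... | inj₂ p≡r = p≡r

  prime∣^ : ∀ {p} m n → Prime p → p ∣ m ^ n → p ∣ m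
  prime∣^ m zero pp p∣1 = contradiction (∣1⇒≡1 p∣1) (prime≢1 pp)
  prime∣^ m (suc n) pp p∣ with euclidsLemma m (m ^ n) pp p∣
  ... | inj₁ p∣m = p∣m
  ... | inj₂ p∣m^n = prime∣^ m n pp p∣m^n

  noCommonPrime⇒coprime : ∀ {m n} → .{{NonZero n}} → (∀ p → Prime p → p ∣ m → ¬ (p ∣ n)) → Coprime m n
  noCommonPrime⇒coprime {m} {n} none {i} (i∣m , i∣n) with i ≟ 1
  ... | yes i≡1 = i≡1
  ... | no i≢1 with primeDivisor i {{≢-nonZero i≢0}} i≢1
    where
    i≢0 : i ≢ 0
    i≢0 refl = ≢-nonZero⁻¹ n (0∣⇒≡0 i∣n)
  ... | p , pp , p∣i = contradiction (∣-trans p∣i i∣n) (none p pp (∣-trans p∣i i∣m))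

  prime∤⇒coprime^ : ∀ {p m} → .{{NonZero m}} → Prime p → ∀ n → ¬ (p ∣ m) → Coprime (p ^ n) m
  prime∤⇒coprime^ {p} {m} pp n p∤m = noCommonPrime⇒coprime
    λ r pr r∣p^n r∣m → p∤m (subst (_∣ m) (prime∣prime pr pp (prime∣^ p n pr r∣p^n)) r∣m)

  strip : ∀ {p} → Prime p → ∀ n → .{{NonZero n}} → ∃₂ λ a m → n ≡ p ^ a * m × ¬ (p ∣ m)
  strip {p} pp n {{nz}} = <-rec P step n nz
    where
    P : ℕ → Set
    P n = .(NonZero n) → ∃₂ λ a m → n ≡ p ^ a * m × ¬ (p ∣ m)
    step : ∀ n → (∀ {m} → m < n → P m) → P n
    step n rec nz with p ∣? n
    ... | no p∤n = 0 , n , sym (*-identityˡ n) , p∤n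
    ... | yes p∣n with rec (quotient-< p∣n {{prime⇒nonTrivial pp}} {{nz}}) (quotient≢0 p∣n {{nz}})
    ...   | a , m , eq , p∤m = suc a , m ,
        trans (m∣n⇒n≡m*quotient p∣n) (trans (cong (p *_) eq) (sym (*-assoc p (p ^ a) m))) , p∤m

  -- Primes shared with `s` are divided out of `n` one at a time until none is left. A prime of `n`
  -- that is lost on the way was therefore shared with `s`.
  coprimePart : ∀ s n → .{{NonZero n}} →
    ∃ λ m → NonZero m × Coprime m s × (∀ p → Prime p → p ∣ n → p ∣ m ⊎ p ∣ s)
  coprimePart s n {{nz}} = <-rec P step n nz
    where
    P : ℕ → Set
    P n = .(NonZero n) → ∃ λ m → NonZero m × Coprime m s × (∀ p → Prime p → p ∣ n → p ∣ m ⊎ p ∣ s)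
    step : ∀ n → (∀ {m} → m < n → P m) → P n
    step n rec nz with gcd n s ≟ 1
    ... | yes gcd≡1 = n , recomputeNZ , Coprimality.gcd≡1⇒coprime gcd≡1 , λ _ _ → inj₁
      where
      recomputeNZ : NonZero n
      recomputeNZ = ≢-nonZero (≢-nonZero⁻¹ n {{nz}})
    ... | no gcd≢1 with primeDivisor (gcd n s)
            {{≢-nonZero λ gcd≡0 → ≢-nonZero⁻¹ n {{nz}} (gcd[m,n]≡0⇒m≡0 gcd≡0)}} gcd≢1
    ...   | l , pl , l∣gcd with ∣-trans l∣gcd (gcd[m,n]∣m n s) | ∣-trans l∣gcd (gcd[m,n]∣n n s)
    ...     | l∣n | l∣s with rec (quotient-< l∣n {{prime⇒nonTrivial pl}} {{nz}}) (quotient≢0 l∣n {{nz}})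
    ...       | m , m≢0 , cop , cover = m , m≢0 , cop , cover′
      where
      cover′ : ∀ p → Prime p → p ∣ n → p ∣ m ⊎ p ∣ s
      cover′ p pp p∣n with euclidsLemma l (quotient l∣n) pp (subst (p ∣_) (m∣n⇒n≡m*quotient l∣n) p∣n)
      ... | inj₁ p∣l = inj₂ (∣-trans p∣l l∣s)
      ... | inj₂ p∣n/l = cover p pp p∣n/l

  -- An elementary substitute for Dirichlet's theorem: units modulo d lift to units modulo n.
  coprimeShift : ∀ {s d} n → .{{NonZero n}} → Coprime s d →
    ∃ λ m → NonZero m × Coprime (s + m * d) n
  coprimeShift {s} {d} n cop with coprimePart s n
  ... | m , m≢0 , m⊥s , cover = m , m≢0 , noCommonPrime⇒coprime none
    where
    none : ∀ p → Prime p → p ∣ s + m * d → ¬ (p ∣ n)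
    -- A prime of `n` divides exactly one of `m` and `s`. In the first case it divides `m * d` but
    -- not `s`; in the second it divides `s` but neither `m` nor `d`.
    none p pp p∣u p∣n with cover p pp p∣n
    ... | inj₁ p∣m = prime≢1 pp (m⊥s (p∣m , ∣m+n∣m⇒∣n (subst (p ∣_) (+-comm s (m * d)) p∣u) (∣m⇒∣m*n d p∣m)))
    ... | inj₂ p∣s with euclidsLemma m d pp (∣m+n∣m⇒∣n p∣u p∣s)
    ...   | inj₁ p∣m = prime≢1 pp (m⊥s (p∣m , p∣s))
    ...   | inj₂ p∣d = prime≢1 pp (cop (p∣s , p∣d))

  coprime-quotients : ∀ m n → .{{_ : NonZero (gcd m n)}} →
    Coprime (quotient (gcd[m,n]∣m m n)) (quotient (gcd[m,n]∣n m n))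
  coprime-quotients m n {i} (i∣m/d , i∣n/d) = ∣1⇒≡1 (*-cancelˡ-∣ d (subst (d * i ∣_) (sym (*-identityʳ d))
    (gcd-greatest
      (subst (d * i ∣_) (sym (m∣n⇒n≡m*quotient (gcd[m,n]∣m m n))) (*-monoʳ-∣ d i∣m/d))
      (subst (d * i ∣_) (sym (m∣n⇒n≡m*quotient (gcd[m,n]∣n m n))) (*-monoʳ-∣ d i∣n/d)))))
    where d = gcd m n

  -- For a prime ℓ dividing n / gcd(m,n) with ℓ^a exactly dividing m, take m′ = m / ℓ^a and n′ = ℓ^(a+1).
  coprimeDivisors : ∀ {m n} → .{{NonZero m}} → .{{NonZero n}} → ¬ (n ∣ m) →
    ∃₂ λ m′ n′ → m′ ∣ m × n′ ∣ n × Coprime m′ n′ × m < m′ * n′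
  coprimeDivisors {m} {n} n∤m with primeDivisor (quotient (gcd[m,n]∣n m n)) {{quotient≢0 (gcd[m,n]∣n m n)}} e≢1
    where
    e≢1 : quotient (gcd[m,n]∣n m n) ≢ 1
    e≢1 eq = n∤m (subst (_∣ m) (sym (trans (m∣n⇒n≡quotient*m (gcd[m,n]∣n m n))
      (trans (cong (_* gcd m n) eq) (*-identityˡ _)))) (gcd[m,n]∣m m n))
  ... | l , pl , l∣e with strip pl m
  ...   | a , m′ , m≡ , l∤m′ =
    m′ , l ^ suc a , subst (m′ ∣_) (sym m≡) (n∣m*n (l ^ a)) , l^∣n ,
    Coprimality.sym (prime∤⇒coprime^ {{m′≢0}} pl (suc a) l∤m′) , m<
    where
    d = gcd m n
    d∣m = gcd[m,n]∣m m n
    d∣n = gcd[m,n]∣n m n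
    m/d = quotient d∣m
    instance
      d≢0 : NonZero d
      d≢0 = ≢-nonZero λ eq → ≢-nonZero⁻¹ m (gcd[m,n]≡0⇒m≡0 {m} {n} eq)
    m′≢0 : NonZero m′
    m′≢0 = ≢-nonZero λ eq → ≢-nonZero⁻¹ m (trans m≡ (trans (cong (l ^ a *_) eq) (*-zeroʳ (l ^ a))))
    -- Since `l` divides `n / d`, it does not divide `m / d`. So all of `l ^ a` lies in `d`, and
    -- `n / d` contributes one more factor `l` to `n`.
    l∤m/d : ¬ (l ∣ m/d)
    l∤m/d l∣ = prime≢1 pl (coprime-quotients m n (l∣ , l∣e))
    l^a∣d : l ^ a ∣ d
    l^a∣d = coprime-divisor (prime∤⇒coprime^ {{quotient≢0 d∣m}} pl a l∤m/d)
      (subst (l ^ a ∣_) (m∣n⇒n≡quotient*m d∣m) (subst (l ^ a ∣_) (sym m≡) (m∣m*n m′)))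
    l^∣n : l ^ suc a ∣ n
    l^∣n = subst (l ^ suc a ∣_) (sym (m∣n⇒n≡quotient*m d∣n)) (*-pres-∣ l∣e l^a∣d)
    m<ml : m < m * l
    m<ml = m<m*n m l (nonTrivial⇒n>1 l {{prime⇒nonTrivial pl}})
    m< : m < m′ * l ^ suc a
    m< = subst (m <_) (trans (cong (_* l) m≡) (trans (*-comm _ l) (trans (sym (*-assoc l (l ^ a) m′)) (*-comm _ m′)))) m<ml

  prime∣!⇒≤ : ∀ {p} n → Prime p → p ∣ n ! → p ≤ n
  prime∣!⇒≤ zero pp p∣1 = contradiction (∣1⇒≡1 p∣1) (prime≢1 pp)
  prime∣!⇒≤ (suc n) pp p∣ with euclidsLemma (suc n) (n !) pp p∣
  ... | inj₁ p∣1+n = ∣⇒≤ p∣1+n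
  ... | inj₂ p∣n! = m≤n⇒m≤1+n (prime∣!⇒≤ n pp p∣n!)

  -- `p` divides p! = C(p,k) k! (p-k)!, and both factorials are products of numbers below `p`.
  prime∣nCk : ∀ {p k} → Prime p → 0 < k → k < p → p ∣ (p C k)
  prime∣nCk {p@(suc _)} {k} pp 0<k k<p with euclidsLemma (p C k) (k ! * (p ∸ k) !) pp
      (subst (p ∣_) p!≡ (m∣m*n _))
    where
    instance _ = k !* (p ∸ k) !≢0
    p!≡ : p ! ≡ (p C k) * (k ! * (p ∸ k) !)
    p!≡ = sym (trans (cong (_* (k ! * (p ∸ k) !)) (nCk≡n!/k![n-k]! (<⇒≤ k<p))) (m/n*n≡m (k![n∸k]!∣n! (<⇒≤ k<p))))
  ... | inj₁ p∣C = p∣C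
  ... | inj₂ p∣ with euclidsLemma (k !) ((p ∸ k) !) pp p∣
  ...   | inj₁ p∣k! = contradiction (prime∣!⇒≤ k pp p∣k!) (<⇒≱ k<p)
  ...   | inj₂ p∣[p∸k]! = contradiction (prime∣!⇒≤ (p ∸ k) pp p∣[p∸k]!) (<⇒≱ (∸-monoʳ-< 0<k (<⇒≤ k<p)))

  -- Horner form of the geometric sum, the recursion that the exponent of `a` follows when x ↦ a x^p
  -- is iterated.
  normExp-suc : ∀ p n → normExp p (suc n) ≡ suc (p * normExp p n)
  normExp-suc p n = cong suc (begin
    sum (map (p ^_) (applyUpTo suc n))          ≡⟨ cong sum (map-applyUpTo suc (p ^_) n) ⟩
    sum (applyUpTo (λ i → p * p ^ i) n)         ≡⟨ cong sum (sym (map-applyUpTo (λ i → p ^ i) (p *_) n)) ⟩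
    sum (map (p *_) (applyUpTo (p ^_) n))       ≡⟨ sum-map-* (applyUpTo (p ^_) n) ⟩
    p * sum (applyUpTo (p ^_) n)                ≡⟨ cong (λ xs → p * sum xs) (sym (map-upTo (p ^_) n)) ⟩
    p * normExp p n                             ∎)
    where
    open ≡-Reasoning
    sum-map-* : ∀ xs → sum (map (p *_) xs) ≡ p * sum xs
    sum-map-* []       = sym (*-zeroʳ p)
    sum-map-* (x ∷ xs) = trans (cong (p * x +_) (sum-map-* xs)) (sym (*-distribˡ-+ p x (sum xs)))

  -- (p − 1)(1 + p + ⋯ + p^(n−1)) = p^n − 1 with p = r + 1.
  *-normExp : ∀ r n → suc (r * normExp (suc r) n) ≡ suc r ^ n
  *-normExp r zero    = cong suc (*-zeroʳ r)
  *-normExp r (suc n) = begin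
    suc (r * normExp p (suc n))        ≡⟨ cong (λ e → suc (r * e)) (normExp-suc p n) ⟩
    suc (r * suc (p * E))              ≡⟨ cong suc (*-suc r (p * E)) ⟩
    p + r * (p * E)                    ≡⟨ cong (p +_) (trans (sym (*-assoc r p E)) (trans (cong (_* E) (*-comm r p)) (*-assoc p r E))) ⟩
    p + p * (r * E)                    ≡⟨ sym (*-suc p (r * E)) ⟩
    p * suc (r * E)                    ≡⟨ cong (p *_) (*-normExp r n) ⟩
    p ^ suc n                          ∎
    where
    open ≡-Reasoning
    p = suc r
    E = normExp p n

open NumberTheory

-- Injective and surjective maps of finite sets.

finInjective⇒surjective : ∀ {m n} → m ≡ n → (f : Fin m → Fin n) → Injective _≡_ _≡_ f →
  ∀ y → ∃ λ x → f x ≡ y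
finInjective⇒surjective {zero} refl f inj ()
finInjective⇒surjective {suc n} refl f inj y with Fin.any? (λ x → f x Fin.≟ y)
... | yes hit = hit
-- Deleting the missed value `y` would leave an injection into a set with one element fewer.
... | no miss = ⊥-elim (Fin.<⇒notInjective (ℕ.n<1+n n) avoid-injective)
  where
  y≢f : ∀ x → y ≢ f x
  y≢f x eq = miss (x , sym eq)
  avoid : Fin (suc n) → Fin n
  avoid x = punchOut (y≢f x)
  avoid-injective : Injective _≡_ _≡_ avoid
  avoid-injective eq = inj (Fin.punchOut-injective (y≢f _) (y≢f _) eq)

bijective⇒↔ : ∀ {A B : Set} (f : A → B) → Injective _≡_ _≡_ f → (∀ y → ∃ λ x → f x ≡ y) → A ↔ B
bijective⇒↔ f inj surj = mk↔ₛ′ f (proj₁ ∘ surj) (proj₂ ∘ surj) (λ x → inj (proj₂ (surj (f x))))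

module Enumerated {n : ℕ} {A : Set} (enum : Fin n ↔ A) where
  infix 4 _≟_

  element : Fin n → A
  element = Inverse.to enum

  position : A → Fin n
  position = Inverse.from enum

  element-position : ∀ x → element (position x) ≡ x
  element-position = Inverse.strictlyInverseˡ enum

  position-element : ∀ i → position (element i) ≡ i
  position-element = Inverse.strictlyInverseʳ enum

  position-injective : Injective _≡_ _≡_ position
  position-injective {x} {y} eq =
    trans (sym (element-position x)) (trans (cong element eq) (element-position y))

  element-injective : Injective _≡_ _≡_ element
  element-injective {i} {j} eq =
    trans (sym (position-element i)) (trans (cong position eq) (position-element j))

  _≟_ : DecidableEquality A
  x ≟ y = map′ position-injective (cong position) (position x Fin.≟ position y)

  any? : ∀ {P : A → Set} → Decidable P → Dec (∃ P)
  any? {P} P? = map′ (λ (i , p) → element i , p)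
                     (λ (x , p) → position x , subst P (sym (element-position x)) p)
                     (Fin.any? (P? ∘ element))

  -- The two sizes may be equal only propositionally: `logarithm` lists 1 + (p-1)M elements of a
  -- field indexed by p^k.
  finiteInjective⇒surjective : ∀ {m} → m ≡ n → (f : Fin m → A) → Injective _≡_ _≡_ f →
    ∀ y → ∃ λ i → f i ≡ y
  finiteInjective⇒surjective m≡n f inj y =
    map₂ position-injective (finInjective⇒surjective m≡n (position ∘ f) (inj ∘ position-injective) (position y))

  injective⇒surjective : (f : A → A) → Injective _≡_ _≡_ f → ∀ y → ∃ λ x → f x ≡ y
  injective⇒surjective f inj y =
    Product.map element (λ eq → eq) (finiteInjective⇒surjective refl (f ∘ element) (element-injective ∘ inj) y)

  -- A section `g` of `f` is injective, hence onto by finiteness, and so it is a two-sided inverse.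
  surjective⇒injective : (f : A → A) → (∀ y → ∃ λ x → f x ≡ y) → Injective _≡_ _≡_ f
  surjective⇒injective f surj {x} {y} fx≡fy = trans (sym (g∘f x)) (trans (cong g fx≡fy) (g∘f y))
    where
    g : A → A
    g = proj₁ ∘ surj
    f∘g : ∀ z → f (g z) ≡ z
    f∘g = proj₂ ∘ surj
    g∘f : ∀ z → g (f z) ≡ z
    g∘f z with injective⇒surjective g (λ {u} {v} eq → trans (sym (f∘g u)) (trans (cong f eq) (f∘g v))) z
    ... | w , refl = cong g (f∘g w)

-- Arithmetic in a finite field.

module FieldTheory {q : ℕ} (F : FiniteField q) where
  open FiniteField F
  open Enumerated enumeration public
  commutativeRing : CommutativeRing 0ℓ 0ℓ
  commutativeRing = record { isCommutativeRing = isCommutativeRing }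
  open CommutativeRing commutativeRing public using
    (+-assoc; +-comm; +-identityˡ; +-identityʳ; -‿inverseˡ; -‿inverseʳ;
     *-assoc; *-comm; *-identityˡ; *-identityʳ; distribˡ; distribʳ; zeroˡ; zeroʳ)
  open RingProperties (CommutativeRing.ring commutativeRing) public using (+-cancelˡ; +-cancelʳ)
  open NaturalCoefficients (CommutativeRing.commutativeSemiring commutativeRing) public
    using (solve; _:=_; _:+_; _:*_)
  open ≡-Reasoning

  *-cancelˡ : ∀ {x} → x ≢ 0# → ∀ {y z} → x * y ≡ x * z → y ≡ z
  *-cancelˡ {x} x≢0 {y} {z} eq with inverse x x≢0
  ... | w , xw≡1 = begin
    y            ≡⟨ sym (*-identityˡ y) ⟩
    1# * y       ≡⟨ cong (_* y) (sym xw≡1) ⟩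
    x * w * y    ≡⟨ rotate x w y ⟩
    w * (x * y)  ≡⟨ cong (w *_) eq ⟩
    w * (x * z)  ≡⟨ sym (rotate x w z) ⟩
    x * w * z    ≡⟨ cong (_* z) xw≡1 ⟩
    1# * z       ≡⟨ *-identityˡ z ⟩
    z            ∎
    where
    rotate : ∀ x w y → x * w * y ≡ w * (x * y)
    rotate = solve 3 (λ x w y → x :* w :* y := w :* (x :* y)) refl

  -- Differences are mostly treated by adding the subtrahend back, after which the identities are
  -- semiring identities.
  difference : ∀ x y → x + - y + y ≡ x
  difference x y = trans (+-assoc x _ _) (trans (cong (x +_) (-‿inverseˡ y)) (+-identityʳ x))

  *-cancelʳ : ∀ {x} → x ≢ 0# → ∀ {y z} → y * x ≡ z * x → y ≡ z
  *-cancelʳ {x} x≢0 {y} {z} eq = *-cancelˡ x≢0 (trans (*-comm x y) (trans eq (*-comm z x)))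

  *-≢0 : ∀ {x y} → x ≢ 0# → y ≢ 0# → x * y ≢ 0#
  *-≢0 {x} x≢0 y≢0 eq = y≢0 (*-cancelˡ x≢0 (trans eq (sym (zeroʳ x))))

  inverse≢0 : ∀ {x y} → x * y ≡ 1# → y ≢ 0#
  inverse≢0 {x} eq refl = 0≢1 (trans (sym (zeroʳ x)) eq)

  ^-≢0 : ∀ {x} → x ≢ 0# → ∀ n → x ^ n ≢ 0#
  ^-≢0 x≢0 zero    = 0≢1 ∘ sym
  ^-≢0 x≢0 (suc n) = *-≢0 x≢0 (^-≢0 x≢0 n)

  ^≡0⇒≡0 : ∀ {x} n → x ^ n ≡ 0# → x ≡ 0#
  ^≡0⇒≡0 {x} n eq with x ≟ 0#
  ... | yes x≡0 = x≡0
  ... | no x≢0 = contradiction eq (^-≢0 x≢0 n)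

  1^ : ∀ n → 1# ^ n ≡ 1#
  1^ zero    = refl
  1^ (suc n) = trans (*-identityˡ _) (1^ n)

  0^ : ∀ n → .{{NonZero n}} → 0# ^ n ≡ 0#
  0^ (suc n) = zeroˡ _

  ^-+ : ∀ x m n → x ^ (m ℕ.+ n) ≡ x ^ m * x ^ n
  ^-+ x zero    n = sym (*-identityˡ _)
  ^-+ x (suc m) n = trans (cong (x *_) (^-+ x m n)) (sym (*-assoc _ _ _))

  ^-* : ∀ x m n → x ^ (m ℕ.* n) ≡ (x ^ m) ^ n
  ^-* x m zero    = cong (x ^_) (ℕ.*-zeroʳ m)
  ^-* x m (suc n) = begin
    x ^ (m ℕ.* suc n)      ≡⟨ cong (x ^_) (ℕ.*-suc m n) ⟩
    x ^ (m ℕ.+ m ℕ.* n)    ≡⟨ ^-+ x m (m ℕ.* n) ⟩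
    x ^ m * x ^ (m ℕ.* n)  ≡⟨ cong (x ^ m *_) (^-* x m n) ⟩
    x ^ m * (x ^ m) ^ n    ∎

  ^-comm : ∀ x m n → (x ^ m) ^ n ≡ (x ^ n) ^ m
  ^-comm x m n = trans (sym (^-* x m n)) (trans (cong (x ^_) (ℕ.*-comm m n)) (^-* x n m))

  *-^ : ∀ x y n → (x * y) ^ n ≡ x ^ n * y ^ n
  *-^ x y zero    = sym (*-identityˡ _)
  *-^ x y (suc n) = trans (cong (x * y *_) (*-^ x y n))
    (solve 4 (λ x y a b → x :* y :* (a :* b) := x :* a :* (y :* b)) refl x y (x ^ n) (y ^ n))

  -- Polynomials and the number of their roots.

  -- A polynomial is represented by its function: Monic n f and Degree< n f provide a Horner form of f.

  Monic : ℕ → (Carrier → Carrier) → Set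
  Monic zero    f = ∀ x → f x ≡ 1#
  Monic (suc n) f = ∃₂ λ h c → Monic n h × (∀ x → f x ≡ x * h x + c)

  Degree< : ℕ → (Carrier → Carrier) → Set
  Degree< zero    f = ∀ x → f x ≡ 0#
  Degree< (suc n) f = ∃₂ λ h c → Degree< n h × (∀ x → f x ≡ x * h x + c)

  monic-^ : ∀ n → Monic n (_^ n)
  monic-^ zero    x = refl
  monic-^ (suc n) = (_^ n) , 0# , monic-^ n , λ x → sym (+-identityʳ _)

  monic⇒degree< : ∀ n {f} → Monic n f → Degree< (suc n) f
  monic⇒degree< zero {f} f≡1 = (λ _ → 0#) , 1# , (λ _ → refl) ,
    λ x → trans (f≡1 x) (sym (trans (cong (_+ 1#) (zeroʳ x)) (+-identityˡ 1#)))
  monic⇒degree< (suc n) (h , c , mh , eq) = h , c , monic⇒degree< n mh , eq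

  degree<-zero : ∀ n → Degree< n (λ _ → 0#)
  degree<-zero zero _ = refl
  degree<-zero (suc n) = (λ _ → 0#) , 0# , degree<-zero n ,
    λ x → sym (trans (+-identityʳ _) (zeroʳ x))

  degree<-weaken : ∀ {m n f} → m ≤ n → Degree< m f → Degree< n f
  degree<-weaken {n = zero} z≤n f≡0 = f≡0
  degree<-weaken {n = suc n} z≤n f≡0 = (λ _ → 0#) , 0# , degree<-zero n ,
    λ x → trans (f≡0 x) (sym (trans (+-identityʳ _) (zeroʳ x)))
  degree<-weaken (s≤s m≤n) (h , c , dh , eq) = h , c , degree<-weaken m≤n dh , eq

  monic-+-degree< : ∀ n {f g} → Monic n f → Degree< n g → Monic n (λ x → f x + g x)
  monic-+-degree< zero mf g≡0 x = trans (cong₂ _+_ (mf x) (g≡0 x)) (+-identityʳ 1#)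
  monic-+-degree< (suc n) (h , c , mh , f≡) (k , d , dk , g≡) =
    (λ x → h x + k x) , c + d , monic-+-degree< n mh dk ,
    λ x → trans (cong₂ _+_ (f≡ x) (g≡ x))
      (solve 5 (λ x h k c d → (x :* h :+ c) :+ (x :* k :+ d) := x :* (h :+ k) :+ (c :+ d)) refl
        x (h x) (k x) c d)

  -- f(x) − f(r) = (x − r) h(x), written without subtraction.
  monic-divide : ∀ n {f} → Monic (suc n) f → ∀ r →
    ∃ λ h → Monic n h × (∀ x → f x + r * h x ≡ f r + x * h x)
  monic-divide zero {f} (h , c , h≡1 , f≡) r = h , h≡1 , λ x → begin
    f x + r * h x               ≡⟨ cong₂ _+_ (f≡ x) (cong (r *_) (trans (h≡1 x) (sym (h≡1 r)))) ⟩
    x * h x + c + r * h r       ≡⟨ solve 3 (λ a b c → a :+ c :+ b := b :+ c :+ a) refl (x * h x) (r * h r) c ⟩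
    r * h r + c + x * h x       ≡⟨ cong (_+ x * h x) (sym (f≡ r)) ⟩
    f r + x * h x               ∎
  monic-divide (suc n) {f} (h , c , mh , f≡) r with monic-divide n mh r
  ... | h₁ , mh₁ , eq = (λ x → x * h₁ x + h r) , (h₁ , h r , mh₁ , λ _ → refl) , λ x → begin
    f x + r * (x * h₁ x + h r)           ≡⟨ cong (_+ r * (x * h₁ x + h r)) (f≡ x) ⟩
    x * h x + c + r * (x * h₁ x + h r)   ≡⟨ solve 6 (λ x h c r h₁ s →
                                               x :* h :+ c :+ r :* (x :* h₁ :+ s) :=
                                               x :* (h :+ r :* h₁) :+ (c :+ r :* s)) refl x (h x) c r (h₁ x) (h r) ⟩
    x * (h x + r * h₁ x) + (c + r * h r) ≡⟨ cong (λ z → x * z + (c + r * h r)) (eq x) ⟩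
    x * (h r + x * h₁ x) + (c + r * h r) ≡⟨ solve 5 (λ x c r h₁ s →
                                               x :* (s :+ x :* h₁) :+ (c :+ r :* s) :=
                                               r :* s :+ c :+ x :* (x :* h₁ :+ s)) refl x c r (h₁ x) (h r) ⟩
    r * h r + c + x * (x * h₁ x + h r)   ≡⟨ cong (_+ x * (x * h₁ x + h r)) (sym (f≡ r)) ⟩
    f r + x * (x * h₁ x + h r)           ∎

  rootBound : ∀ n {m f} → Monic n f → (e : Fin m → Carrier) → Injective _≡_ _≡_ e →
    (∀ i → f (e i) ≡ 0#) → m ≤ n
  rootBound n {zero} _ _ _ _ = z≤n
  rootBound zero {suc m} f≡1 e _ roots = contradiction (trans (sym (roots zero)) (f≡1 (e zero))) 0≢1
  rootBound (suc n) {suc m} {f} mf e inj roots with monic-divide n mf (e zero)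
  ... | h , mh , eq = s≤s (rootBound n mh (e ∘ suc) (Fin.suc-injective ∘ inj) hroots)
    where
    hroots : ∀ i → h (e (suc i)) ≡ 0#
    hroots i with h (e (suc i)) ≟ 0#
    ... | yes h≡0 = h≡0
    -- At two roots the division identity becomes `e zero * h x ≡ x * h x`; cancelling `h x` would
    -- make the two roots equal.
    ... | no h≢0 = case inj (*-cancelʳ h≢0 (+-cancelˡ 0# _ _ (begin
        0# + e zero * h x  ≡⟨ cong (_+ e zero * h x) (sym (roots (suc i))) ⟩
        f x + e zero * h x ≡⟨ eq x ⟩
        f (e zero) + x * h x ≡⟨ cong (_+ x * h x) (roots zero) ⟩
        0# + x * h x ∎))) of λ ()
      where x = e (suc i)

  -- Multiplicative orders and the primitive root.

  record HasOrder (x : Carrier) (n : ℕ) : Set where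
    field
      order≢0       : NonZero n
      ^-order       : x ^ n ≡ 1#
      order-divides : ∀ j → x ^ j ≡ 1# → n ∣ j
  open HasOrder

  ^≡1⇒≢0 : ∀ {x} n → .{{NonZero n}} → x ^ n ≡ 1# → x ≢ 0#
  ^≡1⇒≢0 n x^n≡1 refl = 0≢1 (trans (sym (0^ n)) x^n≡1)

  ^≡1-∣ : ∀ x {m n} → x ^ m ≡ 1# → m ∣ n → x ^ n ≡ 1#
  ^≡1-∣ x {m} eq (divides c refl) =
    trans (cong (x ^_) (ℕ.*-comm c m)) (trans (^-* x m c) (trans (cong (_^ c) eq) (1^ c)))

  ^-cancel : ∀ {x} → x ≢ 0# → ∀ {i j} → i ≤ j → x ^ i ≡ x ^ j → x ^ (j ∸ i) ≡ 1#
  ^-cancel {x} x≢0 {i} {j} i≤j eq = *-cancelˡ (^-≢0 x≢0 i) (begin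
    x ^ i * x ^ (j ∸ i)   ≡⟨ sym (^-+ x i (j ∸ i)) ⟩
    x ^ (i ℕ.+ (j ∸ i))   ≡⟨ cong (x ^_) (ℕ.m+[n∸m]≡n i≤j) ⟩
    x ^ j                 ≡⟨ sym eq ⟩
    x ^ i                 ≡⟨ sym (*-identityʳ _) ⟩
    x ^ i * 1#            ∎)

  -- Any smaller positive exponent restarts the search. Minimality is phrased for remainders:
  -- `hasOrder` applies it to `j % n`.
  leastExponent : ∀ {x} n → NonZero n → x ^ n ≡ 1# →
    ∃ λ m → NonZero m × x ^ m ≡ 1# × (∀ i → i < m → x ^ i ≡ 1# → i ≡ 0)
  leastExponent {x} = <-rec _ step
    where
    P : ℕ → Set
    P n = NonZero n → x ^ n ≡ 1# →
      ∃ λ m → NonZero m × x ^ m ≡ 1# × (∀ i → i < m → x ^ i ≡ 1# → i ≡ 0)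
    step : ∀ n → (∀ {m} → m < n → P m) → P n
    step n rec n≢0 eq with ℕ.anyUpTo? (λ i → ¬? (i ℕ.≟ 0) ×-dec (x ^ i ≟ 1#)) n
    ... | yes (i , i<n , i≢0 , x^i≡1) = rec i<n (ℕ.≢-nonZero i≢0) x^i≡1
    ... | no none = n , n≢0 , eq , λ i i<n x^i≡1 →
      decidable-stable (i ℕ.≟ 0) λ i≢0 → none (i , i<n , i≢0 , x^i≡1)

  ^-% : ∀ x n → .{{_ : NonZero n}} → x ^ n ≡ 1# → ∀ j → x ^ (j % n) ≡ x ^ j
  ^-% x n x^n≡1 j = begin
    x ^ (j % n)                         ≡⟨ sym (*-identityʳ _) ⟩
    x ^ (j % n) * 1#                    ≡⟨ cong (x ^ (j % n) *_) (sym (^≡1-∣ x x^n≡1 (n∣m*n (j / n)))) ⟩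
    x ^ (j % n) * x ^ (j / n ℕ.* n)     ≡⟨ sym (^-+ x (j % n) _) ⟩
    x ^ (j % n ℕ.+ j / n ℕ.* n)         ≡⟨ cong (x ^_) (sym (m≡m%n+[m/n]*n j n)) ⟩
    x ^ j                               ∎

  hasOrder : ∀ {x} → x ≢ 0# → ∃ (HasOrder x)
  -- Two of the q + 1 powers x^0, ..., x^q coincide, and cancelling the lower one leaves a positive
  -- exponent.
  hasOrder {x} x≢0 with Fin.pigeonhole (ℕ.n<1+n q) (λ i → position (x ^ toℕ i))
  ... | i , j , i<j , eq with leastExponent (toℕ j ∸ toℕ i) (ℕ.≢-nonZero (ℕ.m>n⇒m∸n≢0 i<j))
                                (^-cancel x≢0 (ℕ.<⇒≤ i<j) (position-injective eq))
  ...   | n , n≢0 , x^n≡1 , least = n , record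
    { order≢0 = n≢0 ; ^-order = x^n≡1 ; order-divides = λ j x^j≡1 → divides (j / n) (begin
        j                       ≡⟨ m≡m%n+[m/n]*n j n ⟩
        j % n ℕ.+ j / n ℕ.* n   ≡⟨ cong (ℕ._+ j / n ℕ.* n) (least (j % n) (m%n<n j n) (trans (^-% x n x^n≡1 j) x^j≡1)) ⟩
        j / n ℕ.* n             ∎) }
    where
    instance _ = n≢0

  hasOrder⇒≢0 : ∀ {x n} → HasOrder x n → x ≢ 0#
  hasOrder⇒≢0 {n = n} o = ^≡1⇒≢0 n {{order≢0 o}} (^-order o)

  order-^ : ∀ {x} s {m} → HasOrder x (s ℕ.* m) → HasOrder (x ^ s) m
  order-^ {x} s {m} o = record
    { order≢0 = ℕ.m*n≢0⇒n≢0 s {{order≢0 o}}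
    ; ^-order = trans (sym (^-* x s m)) (^-order o)
    ; order-divides = λ j eq → *-cancelˡ-∣ s {{ℕ.m*n≢0⇒m≢0 s {{order≢0 o}}}}
        (order-divides o (s ℕ.* j) (trans (^-* x s j) eq)) }

  order-* : ∀ {x y m n} → Coprime m n → HasOrder x m → HasOrder y n → HasOrder (x * y) (m ℕ.* n)
  order-* {x} {y} {m} {n} cop ox oy = record
    { order≢0 = ℕ.m*n≢0 m n {{order≢0 ox}} {{order≢0 oy}}
    ; ^-order = trans (*-^ x y (m ℕ.* n)) (trans
        (cong₂ _*_ (^≡1-∣ x (^-order ox) (m∣m*n {m} n)) (^≡1-∣ y (^-order oy) (n∣m*n m))) (*-identityʳ 1#))
    ; order-divides = λ j eq → product∣ j
        (part cop ox oy j eq)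
        (part (Coprimality.sym cop) oy ox j (trans (cong (_^ j) (*-comm y x)) eq)) }
    where
    -- Raising to the power `m` removes `x`, which gives `n ∣ m * j`; coprimality then removes `m`.
    part : ∀ {x y m n} → Coprime m n → HasOrder x m → HasOrder y n → ∀ j → (x * y) ^ j ≡ 1# → n ∣ j
    part {x} {y} {m} {n} cop ox oy j eq = coprime-divisor (Coprimality.sym cop) (order-divides oy (m ℕ.* j) (begin
      y ^ (m ℕ.* j)                   ≡⟨ sym (*-identityˡ _) ⟩
      1# * y ^ (m ℕ.* j)              ≡⟨ cong (_* y ^ (m ℕ.* j)) (sym (^≡1-∣ x (^-order ox) (m∣m*n {m} j))) ⟩
      x ^ (m ℕ.* j) * y ^ (m ℕ.* j)   ≡⟨ sym (*-^ x y (m ℕ.* j)) ⟩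
      (x * y) ^ (m ℕ.* j)             ≡⟨ ^≡1-∣ (x * y) eq (n∣m*n m) ⟩
      1#                              ∎))
    product∣ : ∀ j → n ∣ j → m ∣ j → m ℕ.* n ∣ j
    product∣ j (divides c refl) m∣j = *-monoˡ-∣ n (coprime-divisor cop (subst (m ∣_) (ℕ.*-comm c n) m∣j))

  order-^-injective : ∀ {x n} → HasOrder x n → ∀ {i j} → i < n → j < n → x ^ i ≡ x ^ j → i ≡ j
  order-^-injective {x} {n} o {i} {j} i<n j<n eq =
    [ (λ i≤j → half j<n i≤j eq) , (λ j≤i → sym (half i<n j≤i (sym eq))) ]′ (ℕ.≤-total i j)
    where
    half : ∀ {i j} → j < n → i ≤ j → x ^ i ≡ x ^ j → i ≡ j
    half {i} {j} j<n i≤j eq with j ∸ i ℕ.≟ 0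
    ... | yes j∸i≡0 = ℕ.≤-antisym i≤j (ℕ.m∸n≡0⇒m≤n j∸i≡0)
    ... | no j∸i≢0 = contradiction
      (∣⇒≤ {{ℕ.≢-nonZero j∸i≢0}} (order-divides o _ (^-cancel (hasOrder⇒≢0 o) i≤j eq)))
      (ℕ.<⇒≱ (ℕ.≤-<-trans (ℕ.m∸n≤m j i) j<n))

  -- For a generator of the units this lists a whole field: the given field for `g`, the prime field
  -- for `h`. The leading 0 is what makes `order<q` strict.
  zeroOrPower : Carrier → ∀ {n} → Fin (suc n) → Carrier
  zeroOrPower x zero    = 0#
  zeroOrPower x (suc i) = x ^ toℕ i

  zeroOrPower-injective : ∀ {x n} → HasOrder x n → Injective _≡_ _≡_ (zeroOrPower x {n})
  zeroOrPower-injective o {zero}  {zero}  eq = refl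
  zeroOrPower-injective o {zero}  {suc j} eq = contradiction (sym eq) (^-≢0 (hasOrder⇒≢0 o) (toℕ j))
  zeroOrPower-injective o {suc i} {zero}  eq = contradiction eq (^-≢0 (hasOrder⇒≢0 o) (toℕ i))
  zeroOrPower-injective o {suc i} {suc j} eq =
    cong suc (Fin.toℕ-injective (order-^-injective o (Fin.toℕ<n i) (Fin.toℕ<n j) eq))

  order<q : ∀ {x n} → HasOrder x n → n < q
  order<q o = Fin.injective⇒≤ (zeroOrPower-injective o ∘ position-injective)

  -- Suitable powers of `x` and `y` have the coprime orders `m′` and `n′`, so their product has
  -- order `m′ * n′`, which exceeds `m`.
  largerOrder : ∀ {x y m n} → HasOrder x m → HasOrder y n → ¬ (n ∣ m) →
    ∃₂ λ z k → HasOrder z k × m < k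
  largerOrder {x} {y} {m} {n} ox oy n∤m =
    combine (coprimeDivisors {{order≢0 ox}} {{order≢0 oy}} n∤m)
    where
    combine : (∃₂ λ m′ n′ → m′ ∣ m × n′ ∣ n × Coprime m′ n′ × m < m′ ℕ.* n′) →
      ∃₂ λ z k → HasOrder z k × m < k
    combine (m′ , n′ , divides s m≡ , divides t n≡ , cop , m<) =
      x ^ s * y ^ t , m′ ℕ.* n′ ,
      order-* cop (order-^ s (subst (HasOrder x) m≡ ox)) (order-^ t (subst (HasOrder y) n≡ oy)) , m<

  maximalOrder : ∃₂ λ g n → HasOrder g n × (∀ x → x ≢ 0# → x ^ n ≡ 1#)
  maximalOrder = climb q 1# 1 1-order (ℕ.m≤n+m q 1)
    where
    1-order : HasOrder 1# 1
    1-order = record { order≢0 = _ ; ^-order = *-identityʳ 1# ; order-divides = λ j _ → 1∣ j }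
    -- As long as some unit is not killed by `n`, the order can be increased. Orders stay below `q`,
    -- so `q ≤ n + fuel` rules out running out of fuel.
    climb : ∀ fuel g n → HasOrder g n → q ≤ n ℕ.+ fuel →
      ∃₂ λ g n → HasOrder g n × (∀ x → x ≢ 0# → x ^ n ≡ 1#)
    climb zero g n o q≤ = contradiction (subst (q ≤_) (ℕ.+-identityʳ n) q≤) (ℕ.<⇒≱ (order<q o))
    climb (suc fuel) g n o q≤ = attempt (any? (λ x → ¬? (x ≟ 0#) ×-dec ¬? (x ^ n ≟ 1#)))
      where
      attempt : Dec (∃ λ x → x ≢ 0# × x ^ n ≢ 1#) →
        ∃₂ λ g n → HasOrder g n × (∀ x → x ≢ 0# → x ^ n ≡ 1#)
      attempt (no none) = g , n , o , λ x x≢0 →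
        decidable-stable (x ^ n ≟ 1#) λ x^n≢1 → none (x , x≢0 , x^n≢1)
      attempt (yes (x , x≢0 , x^n≢1)) =
        let m , om = hasOrder x≢0
            g′ , n′ , o′ , n<n′ = largerOrder o om λ m∣n → x^n≢1 (^≡1-∣ x (^-order om) m∣n)
        in climb fuel g′ n′ o′
             (ℕ.≤-trans q≤ (ℕ.≤-trans (ℕ.≤-reflexive (ℕ.+-suc n fuel)) (ℕ.+-monoˡ-≤ fuel n<n′)))

  -- All q elements are roots of x (x^n - 1), which has degree n + 1; so q ≤ n + 1, while every
  -- order is below q.
  primitiveRoot : ∃₂ λ g n → q ≡ suc n × HasOrder g n
  primitiveRoot with maximalOrder
  ... | g , n , o , x^n≡1 = g , n , ℕ.≤-antisym q≤ (order<q o) , o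
    where
    root : ∀ x → x * (x ^ n + - 1#) ≡ 0#
    root x with x ≟ 0#
    ... | yes refl = zeroˡ _
    ... | no x≢0 = trans (cong (λ z → x * (z + - 1#)) (x^n≡1 x x≢0))
                         (trans (cong (x *_) (-‿inverseʳ 1#)) (zeroʳ x))
    monic : ∀ n → NonZero n → Monic n (λ x → x ^ n + - 1#)
    monic (suc n) _ = (_^ n) , - 1# , monic-^ n , λ _ → refl
    q≤ : q ≤ suc n
    q≤ = rootBound (suc n) (_ , 0# , monic n (order≢0 o) , λ x → sym (+-identityʳ _)) element element-injective
           (root ∘ element)

  -- Characteristic and Frobenius map.

  open import Algebra.Properties.CommutativeMonoid.Sum (CommutativeRing.+-commutativeMonoid commutativeRing)
    using (sum; sum-permute; ∑-distrib-+; sum-replicate; sum-replicate-zero; sum-cong-≗; sum-init-last)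
  open import Algebra.Properties.Semiring.Mult (CommutativeRing.semiring commutativeRing)
    using (×-assocˡ; ×-assoc-*; ×1-homo-*) renaming (_×_ to _·_)

  -- Translation by 1 permutes the field, so it preserves the sum of all elements.
  q·1≡0 : q · 1# ≡ 0#
  q·1≡0 = +-cancelˡ (sum element) _ _ (begin
    sum element + q · 1#                   ≡⟨ cong (sum element +_) (sym (sum-replicate q)) ⟩
    sum element + sum {q} (λ _ → 1#)       ≡⟨ sym (∑-distrib-+ element (λ _ → 1#)) ⟩
    sum (λ i → element i + 1#)             ≡⟨ sum-cong-≗ (λ i → sym (element-position (element i + 1#))) ⟩
    sum (λ i → element (shift 1# i))       ≡⟨ sym (sum-permute element translation) ⟩
    sum element                            ≡⟨ sym (+-identityʳ _) ⟩
    sum element + 0#                       ∎)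
    where
    shift : Carrier → Fin q → Fin q
    shift c i = position (element i + c)
    shift-shift : ∀ {c d} → c + d ≡ 0# → ∀ i → shift d (shift c i) ≡ i
    shift-shift {c} {d} c+d≡0 i = begin
      position (element (position (element i + c)) + d)  ≡⟨ cong (λ x → position (x + d)) (element-position _) ⟩
      position (element i + c + d)                       ≡⟨ cong position (+-assoc _ c d) ⟩
      position (element i + (c + d))                     ≡⟨ cong (λ x → position (element i + x)) c+d≡0 ⟩
      position (element i + 0#)                          ≡⟨ cong position (+-identityʳ _) ⟩
      position (element i)                               ≡⟨ position-element i ⟩
      i                                                  ∎
    translation : Fin q ↔ Fin q
    translation = mk↔ₛ′ (shift 1#) (shift (- 1#))
      (shift-shift (-‿inverseˡ 1#)) (shift-shift (-‿inverseʳ 1#))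

  ^·1 : ∀ m n → (m ℕ.^ n) · 1# ≡ (m · 1#) ^ n
  ^·1 m zero    = +-identityʳ 1#
  ^·1 m (suc n) = trans (×1-homo-* m (m ℕ.^ n)) (cong (m · 1# *_) (^·1 m n))

  -- (p · 1)^k = q · 1 = 0, and 0 is the only nilpotent element of a field.
  characteristic : ∀ p k → q ≡ p ℕ.^ k → p · 1# ≡ 0#
  characteristic p k q≡ = ^≡0⇒≡0 k (trans (sym (^·1 p k)) (trans (cong (_· 1#) (sym q≡)) q·1≡0))

  multiple-·≡0 : ∀ {p} → p · 1# ≡ 0# → ∀ {n} → p ∣ n → ∀ x → n · x ≡ 0#
  multiple-·≡0 {p} p·1≡0 (divides c refl) x = begin
    (c ℕ.* p) · x      ≡⟨ cong (_· x) (ℕ.*-comm c p) ⟩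
    (p ℕ.* c) · x      ≡⟨ sym (×-assocˡ x p c) ⟩
    p · (c · x)        ≡⟨ cong (p ·_) (sym (*-identityˡ (c · x))) ⟩
    p · (1# * (c · x)) ≡⟨ sym (×-assoc-* p 1# (c · x)) ⟩
    p · 1# * (c · x)   ≡⟨ cong (_* (c · x)) p·1≡0 ⟩
    0# * (c · x)       ≡⟨ zeroˡ _ ⟩
    0#                 ∎

  frobenius-+ : ∀ {p} → Prime p → p · 1# ≡ 0# → ∀ x y → (x + y) ^ p ≡ x ^ p + y ^ p
  frobenius-+ {zero} pp = contradiction pp ¬prime[0]
  frobenius-+ {suc m} pp p·1≡0 x y = begin
    (x + y) ^ p                                   ≡⟨ ^-agree (x + y) p ⟩
    (x + y) ^ˢ p                                  ≡⟨ Binomial.theorem p x y ⟩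
    t zero + sum (t ∘ suc)                        ≡⟨ cong₂ _+_ t-first (sum-init-last (t ∘ suc)) ⟩
    y ^ p + (sum (t ∘ suc ∘ inject₁) + t (fromℕ p)) ≡⟨ cong (y ^ p +_) (cong₂ _+_ t-middle t-last) ⟩
    y ^ p + (0# + x ^ p)                          ≡⟨ cong (y ^ p +_) (+-identityˡ _) ⟩
    y ^ p + x ^ p                                 ≡⟨ +-comm _ _ ⟩
    x ^ p + y ^ p                                 ∎
    where
    import Algebra.Properties.CommutativeSemiring.Binomial (CommutativeRing.commutativeSemiring commutativeRing) as Binomial
    open import Algebra.Properties.Semiring.Exp (CommutativeRing.semiring commutativeRing) using () renaming (_^_ to _^ˢ_)
    p = suc m
    t : Fin (suc p) → Carrier
    t = Binomial.binomialTerm x y p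
    ^-agree : ∀ x n → x ^ n ≡ x ^ˢ n
    ^-agree x zero    = refl
    ^-agree x (suc n) = cong (x *_) (^-agree x n)
    t-first : t zero ≡ y ^ p
    t-first = trans (cong (_· (1# * y ^ˢ p)) (nC0≡1 p)) (trans (+-identityʳ _) (trans (*-identityˡ _) (sym (^-agree y p))))
      where
      nC0≡1 : ∀ n → n C 0 ≡ 1
      nC0≡1 n = trans (nCk≡nC[n∸k] {0} {n} z≤n) (nCn≡1 n)
    t-last : t (fromℕ p) ≡ x ^ p
    t-last = trans (cong (λ j → (p C j) · (x ^ˢ j * y ^ˢ (p ∸ j))) (Fin.toℕ-fromℕ p))
      (trans (cong₂ (λ c j → c · (x ^ˢ p * y ^ˢ j)) (nCn≡1 p) (ℕ.n∸n≡0 p))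
        (trans (+-identityʳ _) (trans (*-identityʳ _) (sym (^-agree x p)))))
    t-middle : sum (t ∘ suc ∘ inject₁) ≡ 0#
    t-middle = trans (sum-cong-≗ (λ i → multiple-·≡0 p·1≡0
        (prime∣nCk pp (s≤s z≤n) (s≤s (subst (_< m) (sym (Fin.toℕ-inject₁ i)) (Fin.toℕ<n i)))) _))
      (sum-replicate-zero m)

-- Indexing the divisors of p - 1.

unique⇒lookup-injective : ∀ {A : Set} {xs : List A} → Unique xs → ∀ i j → lookup xs i ≡ lookup xs j → i ≡ j
unique⇒lookup-injective (x∉ ∷ u) zero    zero    eq = refl
unique⇒lookup-injective (x∉ ∷ u) zero    (suc j) eq = contradiction eq (All.lookup x∉ (∈-lookup j))
unique⇒lookup-injective (x∉ ∷ u) (suc i) zero    eq = contradiction (sym eq) (All.lookup x∉ (∈-lookup i))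
unique⇒lookup-injective (x∉ ∷ u) (suc i) (suc j) eq = cong suc (unique⇒lookup-injective u i j eq)

module Divisors (r : ℕ) .{{_ : NonZero r}} where
  divisors : List ℕ
  divisors = filter (_∣? r) (map suc (upTo r))

  divisors-unique : Unique divisors
  divisors-unique = Unique.filter⁺ (_∣? r) (Unique.map⁺ ℕ.suc-injective (Unique.upTo⁺ r))

  ∣⇒∈divisors : ∀ {e} → e ∣ r → e ∈ divisors
  ∣⇒∈divisors {zero} 0∣r = contradiction (0∣⇒≡0 0∣r) (ℕ.≢-nonZero⁻¹ r)
  ∣⇒∈divisors {suc e} e∣r = ∈-filter⁺ (_∣? r) (∈-map⁺ suc (∈-upTo⁺ (∣⇒≤ e∣r))) e∣r

  divisor : Fin (τ r) → ℕ
  divisor = lookup divisors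

  divisor∣ : ∀ i → divisor i ∣ r
  divisor∣ i = proj₂ (∈-filter⁻ (_∣? r) {xs = map suc (upTo r)} (∈-lookup i))

  divisor-injective : ∀ i j → divisor i ≡ divisor j → i ≡ j
  divisor-injective = unique⇒lookup-injective divisors-unique

  divisorIndex : ∀ {e} → e ∣ r → Fin (τ r)
  divisorIndex = index ∘ ∣⇒∈divisors

  divisor-divisorIndex : ∀ {e} (e∣r : e ∣ r) → divisor (divisorIndex e∣r) ≡ e
  divisor-divisorIndex = sym ∘ lookup-index ∘ ∣⇒∈divisors

-- Conjugacy of dynamical systems.

-- DynEquiv unfolds to a Σ-type; the record lets Agda infer the two systems.
infix 4 _≅_
record _≅_ {S T : Set} (f : S → S) (h : T → T) : Set where
  constructor conjugacy
  field
    σ           : S ↔ T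
    intertwines : ∀ x → Inverse.to σ (f x) ≡ h (Inverse.to σ x)
  open Inverse σ public using (to; from) renaming (strictlyInverseˡ to to∘from; strictlyInverseʳ to from∘to)

≅⇒dynEquiv : ∀ {S T : Set} {f : S → S} {h : T → T} → f ≅ h → DynEquiv f h
≅⇒dynEquiv {f = f} e = σ , λ x → trans (cong from (sym (intertwines x))) (from∘to (f x))
  where open _≅_ e

dynEquiv⇒≅ : ∀ {S T : Set} {f : S → S} {h : T → T} → DynEquiv f h → f ≅ h
dynEquiv⇒≅ {h = h} (σ , eq) = conjugacy σ λ x →
  trans (cong (Inverse.to σ) (sym (eq x))) (Inverse.strictlyInverseˡ σ (h (Inverse.to σ x)))

≅-sym : ∀ {S T : Set} {f : S → S} {h : T → T} → f ≅ h → h ≅ f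
≅-sym {f = f} {h} e = conjugacy (Symmetry.inverse σ) λ y → begin
  from (h y)               ≡⟨ cong (from ∘ h) (sym (to∘from y)) ⟩
  from (h (to (from y)))   ≡⟨ cong from (sym (intertwines (from y))) ⟩
  from (to (f (from y)))   ≡⟨ from∘to _ ⟩
  f (from y)               ∎
  where
  open ≡-Reasoning
  open _≅_ e

≅-trans : ∀ {S T U : Set} {f : S → S} {g : T → T} {h : U → U} → f ≅ g → g ≅ h → f ≅ h
≅-trans (conjugacy σ σ-eq) (conjugacy ρ ρ-eq) = conjugacy (Composition.inverse σ ρ)
  λ x → trans (cong (Inverse.to ρ) (σ-eq x)) (ρ-eq (Inverse.to σ x))

≅-fixedPoint : ∀ {S T : Set} {f : S → S} {h : T → T} → f ≅ h → HasFixedPoint f → HasFixedPoint h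
≅-fixedPoint e (x , fx≡x) = to x , trans (sym (intertwines x)) (cong to fx≡x)
  where open _≅_ e

≅-fold : ∀ {S T : Set} {f : S → S} {h : T → T} (e : f ≅ h) →
  ∀ x n → fold (_≅_.to e x) h n ≡ _≅_.to e (fold x f n)
≅-fold e x zero    = refl
≅-fold {h = h} e x (suc n) = trans (cong h (≅-fold e x n)) (sym (_≅_.intertwines e _))

-- The maps a x^p + b and their linear parts.

module Dynamics (r k : ℕ) (p-prime : Prime (suc r)) (F : FiniteField (suc r ℕ.^ k)) where
  open FiniteField F
  open FieldTheory F
  open HasOrder
  open ≡-Reasoning

  p q M : ℕ
  -- With `p` as a successor, `x ^ p` unfolds to `x * x ^ r`; this is how the exponent p - 1 appears
  -- in scaling and for the prime field.
  p = suc r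
  q = p ℕ.^ k
  M = normExp p k

  N : Carrier → Carrier
  N = Nm F p k

  p·1≡0 = characteristic p k refl

  frobenius : ∀ x y → (x + y) ^ p ≡ x ^ p + y ^ p
  frobenius = frobenius-+ p-prime p·1≡0

  frobeniusⁿ : ∀ n x y → (x + y) ^ (p ℕ.^ n) ≡ x ^ (p ℕ.^ n) + y ^ (p ℕ.^ n)
  frobeniusⁿ zero x y = distribʳ 1# x y
  frobeniusⁿ (suc n) x y = begin
    (x + y) ^ (p ℕ.* p ℕ.^ n)                        ≡⟨ ^-* (x + y) p (p ℕ.^ n) ⟩
    ((x + y) ^ p) ^ (p ℕ.^ n)                        ≡⟨ cong (_^ (p ℕ.^ n)) (frobenius x y) ⟩
    (x ^ p + y ^ p) ^ (p ℕ.^ n)                      ≡⟨ frobeniusⁿ n (x ^ p) (y ^ p) ⟩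
    (x ^ p) ^ (p ℕ.^ n) + (y ^ p) ^ (p ℕ.^ n)        ≡⟨ sym (cong₂ _+_ (^-* x p (p ℕ.^ n)) (^-* y p (p ℕ.^ n))) ⟩
    x ^ (p ℕ.* p ℕ.^ n) + y ^ (p ℕ.* p ℕ.^ n)        ∎

  -- Moving a fixed point to 0 turns x ↦ a x^p + b into this additive map.
  L : Carrier → Carrier → Carrier
  L a x = a * x ^ p

  L-+ : ∀ a x y → L a (x + y) ≡ L a x + L a y
  L-+ a x y = trans (cong (a *_) (frobenius x y)) (distribˡ a _ _)

  -- One more application turns the exponent e of `a` into 1 + p e, which is `normExp-suc`. For n =
  -- k the coefficient is the norm and x^q = x.
  fold-L : ∀ a x n → fold x (L a) n ≡ a ^ normExp p n * x ^ (p ℕ.^ n)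
  fold-L a x zero    = sym (trans (*-identityˡ _) (*-identityʳ x))
  fold-L a x (suc n) = begin
    a * fold x (L a) n ^ p                  ≡⟨ cong (λ y → a * y ^ p) (fold-L a x n) ⟩
    a * (a ^ E * x ^ P) ^ p                 ≡⟨ cong (a *_) (*-^ (a ^ E) (x ^ P) p) ⟩
    a * ((a ^ E) ^ p * (x ^ P) ^ p)         ≡⟨ sym (*-assoc _ _ _) ⟩
    a * (a ^ E) ^ p * (x ^ P) ^ p           ≡⟨ cong₂ (λ y z → a * y * z) (trans (^-comm a E p) (sym (^-* a p E)))
                                                 (trans (^-comm x P p) (sym (^-* x p P))) ⟩
    a ^ suc (p ℕ.* E) * x ^ (p ℕ.* P)       ≡⟨ cong (λ e → a ^ e * x ^ (p ℕ.* P)) (sym (normExp-suc p n)) ⟩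
    a ^ normExp p (suc n) * x ^ (p ℕ.^ suc n) ∎
    where
    E = normExp p n
    P = p ℕ.^ n

  injection⇒≅ : ∀ {f h : Carrier → Carrier} (σ : Carrier → Carrier) → Injective _≡_ _≡_ σ →
    (∀ x → σ (f x) ≡ h (σ x)) → f ≅ h
  injection⇒≅ σ inj = conjugacy (bijective⇒↔ σ inj (injective⇒surjective σ inj))

  ≗⇒≅ : ∀ {f h : Carrier → Carrier} → (∀ x → f x ≡ h x) → f ≅ h
  ≗⇒≅ = injection⇒≅ (λ x → x) (λ eq → eq)

  scaling : ∀ a v → v ≢ 0# → L (a * v ^ r) ≅ L a
  scaling a v v≢0 = injection⇒≅ (v *_) (*-cancelˡ v≢0) λ x → begin
    v * (a * v ^ r * x ^ p)    ≡⟨ solve 4 (λ v a w y → v :* (a :* w :* y) := a :* (v :* w :* y)) refl v a (v ^ r) (x ^ p) ⟩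
    a * (v ^ p * x ^ p)        ≡⟨ cong (a *_) (sym (*-^ v x p)) ⟩
    a * (v * x) ^ p            ∎

  translate-fixedPoint : ∀ {P x₀} → affMap F p P x₀ ≡ x₀ → ∀ y →
    affMap F p P (y + x₀) ≡ L (AffParam.a P) y + x₀
  translate-fixedPoint {param a _ b} {x₀} fixed y = begin
    L a (y + x₀) + b       ≡⟨ cong (_+ b) (L-+ a y x₀) ⟩
    L a y + L a x₀ + b     ≡⟨ +-assoc _ _ b ⟩
    L a y + (L a x₀ + b)   ≡⟨ cong (L a y +_) fixed ⟩
    L a y + x₀             ∎

  linearise : ∀ P → HasFixedPoint (affMap F p P) → L (AffParam.a P) ≅ affMap F p P
  linearise P (x₀ , fixed) = injection⇒≅ (_+ x₀) (+-cancelʳ x₀ _ _)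
    λ y → sym (translate-fixedPoint {P} fixed y)

  -- The order q - 1 is kept as the product `r * M`. Cancelling one factor then shows that g^i has
  -- norm 1 exactly when r divides i, and that g^i lies in the prime field exactly when M divides i.
  module PrimitiveRoot (g : Carrier) (g-order : HasOrder g (r ℕ.* M)) where
    instance
      rM≢0 : NonZero (r ℕ.* M)
      rM≢0 = order≢0 g-order
      r≢0 : NonZero r
      r≢0 = ℕ.m*n≢0⇒m≢0 r
      M≢0 : NonZero M
      M≢0 = ℕ.m*n≢0⇒n≢0 r

    g≢0 = hasOrder⇒≢0 g-order

    logarithm : ∀ x → x ≢ 0# → ∃ λ i → x ≡ g ^ i
    logarithm x x≢0 = toExponent (finiteInjective⇒surjective (*-normExp r k) (zeroOrPower g) (zeroOrPower-injective g-order) x)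
      where
      toExponent : (∃ λ i → zeroOrPower g {r ℕ.* M} i ≡ x) → ∃ λ i → x ≡ g ^ i
      toExponent (zero  , 0≡x)  = contradiction (sym 0≡x) x≢0
      toExponent (suc i , eq) = toℕ i , sym eq

    ^-rM : ∀ x → x ≢ 0# → x ^ (r ℕ.* M) ≡ 1#
    ^-rM x x≢0 with logarithm x x≢0
    ... | i , refl = trans (^-comm g i (r ℕ.* M)) (trans (cong (_^ i) (^-order g-order)) (1^ i))

    ^-q : ∀ x → x ^ q ≡ x
    ^-q x = trans (cong (x ^_) (sym (*-normExp r k))) (x*x^rM≡x (x ≟ 0#))
      where
      x*x^rM≡x : Dec (x ≡ 0#) → x * x ^ (r ℕ.* M) ≡ x
      x*x^rM≡x (yes refl) = zeroˡ _
      x*x^rM≡x (no x≢0) = trans (cong (x *_) (^-rM x x≢0)) (*-identityʳ x)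

    -- The order of the norm, and normal forms with a fixed point.

    fold-L-k : ∀ a x → fold x (L a) k ≡ N a * x
    fold-L-k a x = trans (fold-L a x k) (cong (N a *_) (^-q x))

    fold-L-*k : ∀ a x j → fold x (L a) (j ℕ.* k) ≡ N a ^ j * x
    fold-L-*k a x zero = sym (*-identityˡ x)
    fold-L-*k a x (suc j) = begin
      fold x (L a) (k ℕ.+ j ℕ.* k)            ≡⟨ fold-+ x (L a) k ⟩
      fold (fold x (L a) (j ℕ.* k)) (L a) k   ≡⟨ fold-L-k a _ ⟩
      N a * fold x (L a) (j ℕ.* k)            ≡⟨ cong (N a *_) (fold-L-*k a x j) ⟩
      N a * (N a ^ j * x)                     ≡⟨ sym (*-assoc _ _ _) ⟩
      N a ^ suc j * x                         ∎

    -- N(a)^j = 1 says that the jk-th iterate of L a is the identity, which conjugacy preserves.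
    ≅⇒N^≡1 : ∀ a a′ → L a ≅ L a′ → ∀ j → N a ^ j ≡ 1# → N a′ ^ j ≡ 1#
    ≅⇒N^≡1 a a′ e j eq = begin
      N a′ ^ j                                ≡⟨ sym (*-identityʳ _) ⟩
      N a′ ^ j * 1#                           ≡⟨ sym (fold-L-*k a′ 1# j) ⟩
      fold 1# (L a′) (j ℕ.* k)                ≡⟨ cong (λ y → fold y (L a′) (j ℕ.* k)) (sym (to∘from 1#)) ⟩
      fold (to (from 1#)) (L a′) (j ℕ.* k)    ≡⟨ ≅-fold e (from 1#) (j ℕ.* k) ⟩
      to (fold (from 1#) (L a) (j ℕ.* k))     ≡⟨ cong to (fold-L-*k a (from 1#) j) ⟩
      to (N a ^ j * from 1#)                  ≡⟨ cong (λ y → to (y * from 1#)) eq ⟩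
      to (1# * from 1#)                       ≡⟨ cong to (*-identityˡ _) ⟩
      to (from 1#)                            ≡⟨ to∘from 1# ⟩
      1#                                      ∎
      where open _≅_ e

    N-g^ : ∀ i j → N (g ^ i) ^ j ≡ g ^ (i ℕ.* j ℕ.* M)
    N-g^ i j = begin
      ((g ^ i) ^ M) ^ j      ≡⟨ ^-comm (g ^ i) M j ⟩
      ((g ^ i) ^ j) ^ M      ≡⟨ cong (_^ M) (sym (^-* g i j)) ⟩
      (g ^ (i ℕ.* j)) ^ M    ≡⟨ sym (^-* g (i ℕ.* j) M) ⟩
      g ^ (i ℕ.* j ℕ.* M)    ∎

    N-g^≡1⇒∣ : ∀ i j → N (g ^ i) ^ j ≡ 1# → r ∣ i ℕ.* j
    N-g^≡1⇒∣ i j eq = *-cancelʳ-∣ M (order-divides g-order _ (trans (sym (N-g^ i j)) eq))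

    ∣⇒N-g^≡1 : ∀ i j → r ∣ i ℕ.* j → N (g ^ i) ^ j ≡ 1#
    ∣⇒N-g^≡1 i j r∣ = trans (N-g^ i j) (^≡1-∣ g (^-order g-order) (*-monoˡ-∣ M r∣))

    -- The cofactor c = r / e kills the norm of g^e, hence also that of g^e′. So e c = r divides e′
    -- c, and c cancels.
    normalForms-∣ : ∀ {e e′} → e ∣ r → L (g ^ e) ≅ L (g ^ e′) → e ∣ e′
    normalForms-∣ {e} {e′} e∣r@(divides c r≡ce) equiv = *-cancelʳ-∣ c {{quotient≢0 e∣r}}
      (subst (_∣ e′ ℕ.* c) r≡ec
        (N-g^≡1⇒∣ e′ c (≅⇒N^≡1 (g ^ e) (g ^ e′) equiv c
          (∣⇒N-g^≡1 e c (∣-reflexive r≡ec)))))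
      where
      r≡ec : r ≡ e ℕ.* c
      r≡ec = trans r≡ce (ℕ.*-comm c e)

    normalForms-≡ : ∀ {e e′} → e ∣ r → e′ ∣ r → L (g ^ e) ≅ L (g ^ e′) → e ≡ e′
    normalForms-≡ e∣r e′∣r equiv = ∣-antisym (normalForms-∣ e∣r equiv) (normalForms-∣ e′∣r (≅-sym equiv))

    ^-injective : ∀ u → .{{NonZero u}} → Coprime u (r ℕ.* M) → Injective _≡_ _≡_ (_^ u)
    ^-injective u cop {x} {y} eq with x ≟ 0# | y ≟ 0#
    ... | yes refl | _        = sym (^≡0⇒≡0 u (trans (sym eq) (0^ u)))
    ... | no _     | yes refl = ^≡0⇒≡0 u (trans eq (0^ u))
    ... | no x≢0   | no y≢0   = byBézout (coprime-Bézout cop)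
      where
      byBézout : Bézout.Identity 1 u (r ℕ.* M) → x ≡ y
      byBézout (Bézout.+- c d 1+dn≡cu) = trans (unpower x x≢0) (trans (cong (_^ c) eq) (sym (unpower y y≢0)))
        where
        unpower : ∀ z → z ≢ 0# → z ≡ (z ^ u) ^ c
        unpower z z≢0 = begin
          z                              ≡⟨ sym (*-identityʳ z) ⟩
          z * 1#                         ≡⟨ cong (z *_) (sym (^≡1-∣ z (^-rM z z≢0) (n∣m*n d))) ⟩
          z ^ suc (d ℕ.* (r ℕ.* M))      ≡⟨ cong (z ^_) (trans 1+dn≡cu (ℕ.*-comm c u)) ⟩
          z ^ (u ℕ.* c)                  ≡⟨ ^-* z u c ⟩
          (z ^ u) ^ c                    ∎
      -- With this sign of the Bézout identity the c-th power of z^u is the inverse of z, not z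
      -- itself.
      byBézout (Bézout.-+ c d 1+cu≡dn) = *-cancelʳ (^-≢0 (^-≢0 x≢0 u) c)
        (trans (unpower x x≢0) (sym (trans (cong (λ w → y * w ^ c) eq) (unpower y y≢0))))
        where
        unpower : ∀ z → z ≢ 0# → z * (z ^ u) ^ c ≡ 1#
        unpower z z≢0 = begin
          z * (z ^ u) ^ c                ≡⟨ cong (z *_) (sym (^-* z u c)) ⟩
          z ^ suc (u ℕ.* c)              ≡⟨ cong (z ^_) (trans (cong suc (ℕ.*-comm u c)) 1+cu≡dn) ⟩
          z ^ (d ℕ.* (r ℕ.* M))          ≡⟨ ^≡1-∣ z (^-rM z z≢0) (n∣m*n d) ⟩
          1#                             ∎

    powering : ∀ a u → .{{NonZero u}} → Coprime u (r ℕ.* M) → L a ≅ L (a ^ u)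
    powering a u cop = injection⇒≅ (_^ u) (^-injective u cop)
      λ x → trans (*-^ a (x ^ p) u) (cong (a ^ u *_) (^-comm x p u))

    -- With s = i / e and d = r / e coprime, choose u = s + m d prime to q - 1. Then e u = i + m r,
    -- so (g^e)^u is g^i times the r-th power of g^m, a factor that scaling removes.
    L-normalForm : ∀ i → L (g ^ i) ≅ L (g ^ gcd i r)
    L-normalForm i = lift (coprimeShift (r ℕ.* M) (coprime-quotients i r))
      where
      e = gcd i r
      s = quotient (gcd[m,n]∣m i r)
      d = quotient (gcd[m,n]∣n i r)
      instance
        e≢0 : NonZero e
        e≢0 = ℕ.≢-nonZero λ eq → ℕ.≢-nonZero⁻¹ r (gcd[m,n]≡0⇒n≡0 i eq)
        d≢0 : NonZero d
        d≢0 = quotient≢0 (gcd[m,n]∣n i r)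
      lift : (∃ λ m → NonZero m × Coprime (s ℕ.+ m ℕ.* d) (r ℕ.* M)) → L (g ^ i) ≅ L (g ^ e)
      lift (m , m≢0 , cop) = ≅-sym (≅-trans (powering (g ^ e) u {{u≢0}} cop)
        (subst (λ a → L a ≅ L (g ^ i)) (sym g^eu) (scaling (g ^ i) (g ^ m) (^-≢0 g≢0 m))))
        where
        u = s ℕ.+ m ℕ.* d
        -- Coprimality to q - 1 alone would allow u = 0 when q = 2, and x ↦ x^0 is constant; this is
        -- why `coprimeShift` supplies a nonzero `m`.
        u≢0 : NonZero u
        u≢0 = ℕ.>-nonZero (ℕ.<-≤-trans (ℕ.>-nonZero⁻¹ (m ℕ.* d) {{ℕ.m*n≢0 m d {{m≢0}}}}) (ℕ.m≤n+m _ s))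
        eu≡ : e ℕ.* u ≡ i ℕ.+ m ℕ.* r
        eu≡ = trans (ℕ.*-distribˡ-+ e s (m ℕ.* d)) (cong₂ ℕ._+_
          (sym (m∣n⇒n≡m*quotient (gcd[m,n]∣m i r)))
          (trans (sym (ℕ.*-assoc e m d)) (trans (cong (ℕ._* d) (ℕ.*-comm e m))
            (trans (ℕ.*-assoc m e d) (cong (m ℕ.*_) (sym (m∣n⇒n≡m*quotient (gcd[m,n]∣n i r))))))))
        g^eu : (g ^ e) ^ u ≡ g ^ i * (g ^ m) ^ r
        g^eu = begin
          (g ^ e) ^ u              ≡⟨ sym (^-* g e u) ⟩
          g ^ (e ℕ.* u)            ≡⟨ cong (g ^_) eu≡ ⟩
          g ^ (i ℕ.+ m ℕ.* r)      ≡⟨ ^-+ g i (m ℕ.* r) ⟩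
          g ^ i * g ^ (m ℕ.* r)    ≡⟨ cong (g ^ i *_) (^-* g m r) ⟩
          g ^ i * (g ^ m) ^ r      ∎

    -- A fixed point is also fixed by the k-th iterate, which is multiplication by `N a`.
    L-fixed⇒N≡1 : ∀ {a y} → L a y ≡ y → y ≢ 0# → N a ≡ 1#
    L-fixed⇒N≡1 {a} {y} Ly≡y y≢0 = *-cancelʳ y≢0
      (trans (sym (fold-L-k a y)) (trans (fold-fixed k) (sym (*-identityˡ y))))
      where
      fold-fixed : ∀ n → fold y (L a) n ≡ y
      fold-fixed zero    = refl
      fold-fixed (suc n) = trans (cong (L a) (fold-fixed n)) Ly≡y

    -- Hilbert 90 for the norm.
    N≡1⇒power : ∀ {a} → a ≢ 0# → N a ≡ 1# → ∃ λ v → v ≢ 0# × a ≡ v ^ r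
    N≡1⇒power {a} a≢0 Na≡1 with logarithm a a≢0
    ... | i , refl with subst (r ∣_) (ℕ.*-identityʳ i) (N-g^≡1⇒∣ i 1 (trans (*-identityʳ _) Na≡1))
    ...   | divides c refl = g ^ c , ^-≢0 g≢0 c , ^-* g c r

    -- If x - L a x took the same value at two points, their difference would be a nonzero fixed
    -- point of `L a`. So `D` is injective, hence onto, and a preimage of `b` is the fixed point.
    fixedPoint : ∀ a → N a ≢ 1# → ∀ b → ∃ λ x → L a x + b ≡ x
    fixedPoint a Na≢1 b = recover (injective⇒surjective D D-injective b)
      where
      D : Carrier → Carrier
      D x = x + - L a x
      D-injective : Injective _≡_ _≡_ D
      D-injective {x} {y} Dx≡Dy with x + - y ≟ 0#
      ... | yes z≡0 = +-cancelʳ (- y) x y (trans z≡0 (sym (-‿inverseʳ y)))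
      ... | no z≢0 = contradiction (L-fixed⇒N≡1 Lz≡z z≢0) Na≢1
        where
        z = x + - y
        x≡z+y : x ≡ z + y
        x≡z+y = sym (difference x y)
        Lz≡z : L a z ≡ z
        Lz≡z = +-cancelʳ y _ _ (begin
          L a z + y                     ≡⟨ cong (L a z +_) (sym (difference y (L a y))) ⟩
          L a z + (D y + L a y)         ≡⟨ solve 3 (λ u v w → u :+ (v :+ w) := v :+ (u :+ w)) refl (L a z) (D y) (L a y) ⟩
          D y + (L a z + L a y)         ≡⟨ cong₂ _+_ (sym Dx≡Dy) (sym (L-+ a z y)) ⟩
          D x + L a (z + y)             ≡⟨ cong (λ w → D x + L a w) (sym x≡z+y) ⟩
          D x + L a x                   ≡⟨ difference x (L a x) ⟩
          x                             ≡⟨ x≡z+y ⟩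
          z + y                         ∎)
      recover : (∃ λ x → D x ≡ b) → ∃ λ x → L a x + b ≡ x
      recover (x , refl) = x , trans (+-comm _ _) (difference x (L a x))

    noFixedPoint⇒N≡1 : ∀ P → ¬ HasFixedPoint (affMap F p P) → N (AffParam.a P) ≡ 1#
    noFixedPoint⇒N≡1 (param a _ b) none with N a ≟ 1#
    ... | yes Na≡1 = Na≡1
    ... | no Na≢1 = contradiction (fixedPoint a Na≢1 b) none

    -- The trace, and the maps without fixed points.

    -- T n x = x + x^p + ⋯ + x^(p^(n−1)), so that T k is the trace to the prime field.
    T : ℕ → Carrier → Carrier
    T zero    x = 0#
    T (suc n) x = x ^ (p ℕ.^ n) + T n x

    Tr : Carrier → Carrier
    Tr = T k

    0^p : 0# ^ p ≡ 0#
    0^p = zeroˡ _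

    -- The p-th power moves every term of the sum to the next one; `x` is the first term that is
    -- then missing.
    T-frobenius : ∀ n x → x + T n x ^ p ≡ T (suc n) x
    T-frobenius zero x = cong₂ _+_ (sym (*-identityʳ x)) 0^p
    T-frobenius (suc n) x = begin
      x + (x ^ P + T n x) ^ p            ≡⟨ cong (x +_) (frobenius _ _) ⟩
      x + ((x ^ P) ^ p + T n x ^ p)      ≡⟨ solve 3 (λ x u v → x :+ (u :+ v) := u :+ (x :+ v)) refl x ((x ^ P) ^ p) (T n x ^ p) ⟩
      (x ^ P) ^ p + (x + T n x ^ p)      ≡⟨ cong₂ _+_ (trans (^-comm x P p) (sym (^-* x p P))) (T-frobenius n x) ⟩
      T (suc (suc n)) x                  ∎
      where P = p ℕ.^ n

    -- `T (suc k) x` split at its two ends is x + Tr(x)^p and x^q + Tr(x), with x^q = x. The trace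
    -- thus lies in the prime field.
    Tr^p : ∀ x → Tr x ^ p ≡ Tr x
    Tr^p x = +-cancelˡ x _ _ (trans (T-frobenius k x) (cong (_+ Tr x) (^-q x)))

    T-+ : ∀ n x y → T n (x + y) ≡ T n x + T n y
    T-+ zero    x y = sym (+-identityʳ 0#)
    T-+ (suc n) x y = trans (cong₂ _+_ (frobeniusⁿ n x y) (T-+ n x y))
      (solve 4 (λ a b c d → (a :+ b) :+ (c :+ d) := (a :+ c) :+ (b :+ d)) refl
        (x ^ (p ℕ.^ n)) (y ^ (p ℕ.^ n)) (T n x) (T n y))

    -- Membership in the prime field is expressed by c^p = c; such scalars can be pulled out of `T`.
    ^pⁿ : ∀ {c} → c ^ p ≡ c → ∀ n → c ^ (p ℕ.^ n) ≡ c
    ^pⁿ c^p≡c zero = *-identityʳ _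
    ^pⁿ {c} c^p≡c (suc n) = trans (^-* c p (p ℕ.^ n)) (trans (cong (_^ (p ℕ.^ n)) c^p≡c) (^pⁿ c^p≡c n))

    T-* : ∀ n {c} x → c ^ p ≡ c → T n (c * x) ≡ c * T n x
    T-* zero {c} x _ = sym (zeroʳ c)
    T-* (suc n) {c} x c^p≡c = trans
      (cong₂ _+_ (trans (*-^ c x (p ℕ.^ n)) (cong (_* x ^ (p ℕ.^ n)) (^pⁿ c^p≡c n))) (T-* n x c^p≡c))
      (sym (distribˡ c _ _))

    p^n<p^1+n : ∀ n → p ℕ.^ n < p ℕ.^ suc n
    p^n<p^1+n n = ℕ.^-monoʳ-< p (s≤s (ℕ.>-nonZero⁻¹ r)) (ℕ.n<1+n n)

    -- Mutual with `T-monic`: x^(p^n) leads in `T (suc n)` only because `T n` has smaller degree,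
    -- which in turn comes from the leading term one level down.
    T-degree : ∀ n → Degree< (p ℕ.^ n) (T n)
    T-monic : ∀ n → Monic (p ℕ.^ n) (T (suc n))
    T-degree zero = degree<-zero 1
    T-degree (suc n) = degree<-weaken (p^n<p^1+n n) (monic⇒degree< (p ℕ.^ n) (T-monic n))
    T-monic n = monic-+-degree< (p ℕ.^ n) (monic-^ (p ℕ.^ n)) (T-degree n)

    -- The trace is a monic polynomial of degree p^(k-1), too small to vanish at all p^k elements.
    trace≢0 : ∃ λ x → Tr x ≢ 0#
    trace≢0 with any? (λ x → ¬? (Tr x ≟ 0#))
    ... | yes found = found
    ... | no none = ⊥-elim (tooManyRoots k refl λ x → decidable-stable (Tr x ≟ 0#) λ Tr≢0 → none (x , Tr≢0))
      where
      -- `k` is opened through an equation because the field itself is indexed by p^k. The case k =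
      -- 0 contradicts M ≠ 0.
      tooManyRoots : ∀ n → k ≡ n → (∀ x → T n x ≡ 0#) → ⊥
      tooManyRoots zero    k≡0 _ = ℕ.≢-nonZero⁻¹ M (cong (normExp p) k≡0)
      tooManyRoots (suc n) k≡1+n T≡0 = ℕ.<⇒≱ (p^n<p^1+n n)
        (subst (λ m → p ℕ.^ m ≤ p ℕ.^ n) k≡1+n (rootBound (p ℕ.^ n) (T-monic n) element element-injective (T≡0 ∘ element)))

    -- A nonzero trace lies in the prime field, so its inverse does too and commutes with `Tr`.
    trace≡1 : ∃ λ x → Tr x ≡ 1#
    trace≡1 = normalise trace≢0
      where
      normalise : (∃ λ x → Tr x ≢ 0#) → ∃ λ x → Tr x ≡ 1#
      normalise (x , t≢0) = w * x , trans (T-* k x w^p≡w) wt≡1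
        where
        t = Tr x
        w = proj₁ (inverse t t≢0)
        wt≡1 : w * t ≡ 1#
        wt≡1 = trans (*-comm w t) (proj₂ (inverse t t≢0))
        w^p≡w : w ^ p ≡ w
        w^p≡w = *-cancelʳ t≢0 (begin
          w ^ p * t       ≡⟨ cong (w ^ p *_) (sym (Tr^p x)) ⟩
          w ^ p * t ^ p   ≡⟨ sym (*-^ w t p) ⟩
          (w * t) ^ p     ≡⟨ cong (_^ p) wt≡1 ⟩
          1# ^ p          ≡⟨ 1^ p ⟩
          1#              ≡⟨ sym wt≡1 ⟩
          w * t           ∎)

    -- For Tr θ = 1 and Tr b = 0 the element Σ_{i<k} T_i(b) θ^(p^i) solves x^p + b = x, because
    -- T_i(b)^p + b = T_{i+1}(b).
    additiveHilbert90 : ∀ b → Tr b ≡ 0# → ∃ λ x → x ^ p + b ≡ x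
    additiveHilbert90 b Trb≡0 = fromTraceOne trace≡1
      where
      fromTraceOne : (∃ λ θ → Tr θ ≡ 1#) → ∃ λ x → x ^ p + b ≡ x
      fromTraceOne (θ , Trθ≡1) = U k , (begin
        U k ^ p + b                ≡⟨ cong (U k ^ p +_) (sym (*-identityʳ b)) ⟩
        U k ^ p + b * 1#           ≡⟨ cong (λ t → U k ^ p + b * t) (sym (trans (cong (_^ p) Trθ≡1) (1^ p))) ⟩
        U k ^ p + b * Tr θ ^ p     ≡⟨ U-frobenius k ⟩
        Tr b * θ ^ q + U k         ≡⟨ cong (λ t → t * θ ^ q + U k) Trb≡0 ⟩
        0# * θ ^ q + U k           ≡⟨ cong (_+ U k) (zeroˡ _) ⟩
        0# + U k                   ≡⟨ +-identityˡ _ ⟩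
        U k                        ∎)
        where
        U : ℕ → Carrier
        U zero    = 0#
        U (suc n) = T n b * θ ^ (p ℕ.^ n) + U n
        -- Partial sums satisfy the equation only with `b` weighted by T_n(θ)^p. At n = k this
        -- weight is 1, and the extra term of `U (suc k)` carries the factor Tr(b) = 0.
        U-frobenius : ∀ n → U n ^ p + b * T n θ ^ p ≡ U (suc n)
        U-frobenius zero = begin
          0# ^ p + b * 0# ^ p   ≡⟨ cong₂ (λ u v → u + b * v) 0^p 0^p ⟩
          0# + b * 0#           ≡⟨ cong (0# +_) (zeroʳ b) ⟩
          0# + 0#               ≡⟨ cong (_+ 0#) (sym (zeroˡ _)) ⟩
          U 1                   ∎
        U-frobenius (suc n) = begin
          (t * y + U n) ^ p + b * (y + T n θ) ^ p
            ≡⟨ cong₂ (λ u v → u + b * v)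
                 (trans (frobenius _ _) (cong (_+ U n ^ p) (*-^ t y p))) (frobenius _ _) ⟩
          (t ^ p * y ^ p + U n ^ p) + b * (y ^ p + T n θ ^ p)
            ≡⟨ solve 5 (λ t y u b s → (t :* y :+ u) :+ b :* (y :+ s) := (b :+ t) :* y :+ (u :+ b :* s)) refl
                 (t ^ p) (y ^ p) (U n ^ p) b (T n θ ^ p) ⟩
          (b + t ^ p) * y ^ p + (U n ^ p + b * T n θ ^ p)
            ≡⟨ cong₂ _+_ (cong₂ _*_ (T-frobenius n b) (trans (^-comm θ P p) (sym (^-* θ p P)))) (U-frobenius n) ⟩
          U (suc (suc n)) ∎
          where
          P = p ℕ.^ n
          t = T n b
          y = θ ^ P

    fixedPointFree⇒Tr≢0 : ∀ b → ¬ HasFixedPoint (λ x → x ^ p + b) → Tr b ≢ 0#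
    fixedPointFree⇒Tr≢0 b none = none ∘ additiveHilbert90 b

    -- The quotient c = Tr(b′)/Tr(b) lies in the prime field, so d = b′ - c b has trace 0. A
    -- solution y of y^p + d = y is then the translation part of x ↦ c x + y.
    fixedPointFree-conjugate : ∀ b b′ → ¬ HasFixedPoint (λ x → x ^ p + b) → ¬ HasFixedPoint (λ x → x ^ p + b′) →
      (λ x → x ^ p + b) ≅ (λ x → x ^ p + b′)
    fixedPointFree-conjugate b b′ none none′ = conjugate (additiveHilbert90 d Trd≡0)
      where
      t≢0 = fixedPointFree⇒Tr≢0 b none
      s = proj₁ (inverse (Tr b) t≢0)
      ts≡1 = proj₂ (inverse (Tr b) t≢0)
      c = Tr b′ * s
      c*Trb : c * Tr b ≡ Tr b′
      c*Trb = trans (*-assoc _ _ _) (trans (cong (Tr b′ *_) (trans (*-comm s _) ts≡1)) (*-identityʳ _))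
      c≢0 : c ≢ 0#
      c≢0 = *-≢0 (fixedPointFree⇒Tr≢0 b′ none′) (inverse≢0 ts≡1)
      c^p≡c : c ^ p ≡ c
      c^p≡c = *-cancelʳ t≢0 (begin
        c ^ p * Tr b         ≡⟨ cong (c ^ p *_) (sym (Tr^p b)) ⟩
        c ^ p * Tr b ^ p     ≡⟨ sym (*-^ c (Tr b) p) ⟩
        (c * Tr b) ^ p       ≡⟨ cong (_^ p) c*Trb ⟩
        Tr b′ ^ p            ≡⟨ Tr^p b′ ⟩
        Tr b′                ≡⟨ sym c*Trb ⟩
        c * Tr b             ∎)
      d = b′ + - (c * b)
      d+cb≡b′ : d + c * b ≡ b′
      d+cb≡b′ = difference b′ (c * b)
      Trd≡0 : Tr d ≡ 0#
      Trd≡0 = +-cancelʳ (c * Tr b) _ _ (begin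
        Tr d + c * Tr b      ≡⟨ cong (Tr d +_) (sym (T-* k b c^p≡c)) ⟩
        Tr d + Tr (c * b)    ≡⟨ sym (T-+ k d (c * b)) ⟩
        Tr (d + c * b)       ≡⟨ cong Tr d+cb≡b′ ⟩
        Tr b′                ≡⟨ sym c*Trb ⟩
        c * Tr b             ≡⟨ sym (+-identityˡ _) ⟩
        0# + c * Tr b        ∎)
      conjugate : (∃ λ y → y ^ p + d ≡ y) → (λ x → x ^ p + b) ≅ (λ x → x ^ p + b′)
      conjugate (y , y^p+d≡y) = injection⇒≅ (λ x → c * x + y)
        (λ eq → *-cancelˡ c≢0 (+-cancelʳ y _ _ eq))
        λ x → begin
          c * (x ^ p + b) + y                   ≡⟨ cong (c * (x ^ p + b) +_) (sym y^p+d≡y) ⟩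
          c * (x ^ p + b) + (y ^ p + d)         ≡⟨ solve 5 (λ c u b v d → c :* (u :+ b) :+ (v :+ d) := c :* u :+ v :+ (d :+ c :* b)) refl
                                                     c (x ^ p) b (y ^ p) d ⟩
          c * x ^ p + y ^ p + (d + c * b)       ≡⟨ cong₂ (λ u v → u * x ^ p + y ^ p + v) (sym c^p≡c) d+cb≡b′ ⟩
          c ^ p * x ^ p + y ^ p + b′            ≡⟨ cong (λ u → u + y ^ p + b′) (sym (*-^ c x p)) ⟩
          (c * x) ^ p + y ^ p + b′              ≡⟨ cong (_+ b′) (sym (frobenius (c * x) y)) ⟩
          (c * x + y) ^ p + b′                  ∎

    N≡1⇒monicForm : ∀ P → N (AffParam.a P) ≡ 1# → ∃ λ b → affMap F p P ≅ (λ x → x ^ p + b)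
    N≡1⇒monicForm (param a a≢0 b) Na≡1 with N≡1⇒power a≢0 Na≡1
    ... | v , v≢0 , refl = v * b , injection⇒≅ (v *_) (*-cancelˡ v≢0) λ x → begin
      v * (v ^ r * x ^ p + b)      ≡⟨ solve 4 (λ v w y b → v :* (w :* y :+ b) := v :* w :* y :+ v :* b) refl v (v ^ r) (x ^ p) b ⟩
      v ^ p * x ^ p + v * b        ≡⟨ cong (_+ v * b) (sym (*-^ v x p)) ⟩
      (v * x) ^ p + v * b          ∎

    fixedPointFree-unique : ∀ P Q → ¬ HasFixedPoint (affMap F p P) → ¬ HasFixedPoint (affMap F p Q) →
      affMap F p P ≅ affMap F p Q
    fixedPointFree-unique P Q noneP noneQ =
      let b  , P≅b  = N≡1⇒monicForm P (noFixedPoint⇒N≡1 P noneP)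
          b′ , Q≅b′ = N≡1⇒monicForm Q (noFixedPoint⇒N≡1 Q noneQ)
      in ≅-trans P≅b (≅-trans
           (fixedPointFree-conjugate b b′ (noneP ∘ ≅-fixedPoint (≅-sym P≅b)) (noneQ ∘ ≅-fixedPoint (≅-sym Q≅b′)))
           (≅-sym Q≅b′))

    hasFixedPoint? : ∀ (f : Carrier → Carrier) → Dec (HasFixedPoint f)
    hasFixedPoint? f = any? (λ x → f x ≟ x)

    1≢0 : 1# ≢ 0#
    1≢0 = 0≢1 ∘ sym

    -- x ↦ x − x^p vanishes at 0 and 1, hence misses some b.
    fixedPointFree-exists : ∃ λ P → ¬ HasFixedPoint (affMap F p P)
    fixedPointFree-exists with any? (λ b → ¬? (hasFixedPoint? (affMap F p (param 1# 1≢0 b))))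
    ... | yes (b , none) = param 1# 1≢0 b , none
    ... | no all = ⊥-elim (0≢1 (surjective⇒injective D D-surjective (trans D0≡0 (sym D1≡0))))
      where
      D : Carrier → Carrier
      D x = x + - L 1# x
      D0≡0 : D 0# ≡ 0#
      D0≡0 = trans (cong (λ u → 0# + - u) (trans (*-identityˡ _) 0^p)) (-‿inverseʳ 0#)
      D1≡0 : D 1# ≡ 0#
      D1≡0 = trans (cong (λ u → 1# + - u) (trans (*-identityˡ _) (1^ p))) (-‿inverseʳ 1#)
      D-surjective : ∀ b → ∃ λ x → D x ≡ b
      D-surjective b with decidable-stable (hasFixedPoint? (affMap F p (param 1# 1≢0 b))) (λ none → all (b , none))
      ... | x , fixed = x , (begin
        x + - L 1# x                  ≡⟨ cong (_+ - L 1# x) (sym fixed) ⟩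
        L 1# x + b + - L 1# x         ≡⟨ cong (_+ - L 1# x) (+-comm (L 1# x) b) ⟩
        b + L 1# x + - L 1# x         ≡⟨ +-assoc b _ _ ⟩
        b + (L 1# x + - L 1# x)       ≡⟨ cong (b +_) (-‿inverseʳ _) ⟩
        b + 0#                        ≡⟨ +-identityʳ b ⟩
        b                             ∎)

    -- Counting fixed points.

    fixed-≡ : ∀ {f : Carrier → Carrier} {s t : ∃ λ x → f x ≡ x} → proj₁ s ≡ proj₁ t → s ≡ t
    -- Equality is decidable, so the attached proofs are unique and counting pairs means counting
    -- points.
    fixed-≡ {s = x , _} {.x , _} refl = cong (x ,_) (Decidable⇒UIP.≡-irrelevant _≟_ _ _)

    -- The exponent is (q - 1)/(p - 1), so this generates the unit group of the prime field.
    h : Carrier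
    h = g ^ M

    h-order : HasOrder h r
    h-order = order-^ M (subst (HasOrder g) (ℕ.*-comm r M) g-order)

    primeField : Fin p → Carrier
    primeField = zeroOrPower h

    primeField-fixed : ∀ i → primeField i ^ p ≡ primeField i
    primeField-fixed zero    = 0^p
    primeField-fixed (suc i) = trans (cong (h ^ toℕ i *_)
      (trans (^-comm h (toℕ i) r) (trans (cong (_^ toℕ i) (^-order h-order)) (1^ (toℕ i))))) (*-identityʳ _)

    -- For w = g^j nonzero, w^r = 1 gives r M ∣ j r, hence M ∣ j, and w is a power of `h`.
    primeField-complete : ∀ w → w ^ p ≡ w → ∃ λ i → primeField i ≡ w
    primeField-complete w w^p≡w = split (w ≟ 0#)
      where
      power : ∀ j → w ≡ g ^ j → M ∣ j → ∃ λ i → primeField i ≡ w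
      power j w≡g^j (divides c j≡cM) = suc (fromℕ< (m%n<n c r)) , (begin
        h ^ toℕ (fromℕ< (m%n<n c r))   ≡⟨ cong (h ^_) (Fin.toℕ-fromℕ< (m%n<n c r)) ⟩
        h ^ (c % r)                    ≡⟨ ^-% h r (^-order h-order) c ⟩
        h ^ c                          ≡⟨ sym (^-* g M c) ⟩
        g ^ (M ℕ.* c)                  ≡⟨ cong (g ^_) (trans (ℕ.*-comm M c) (sym j≡cM)) ⟩
        g ^ j                          ≡⟨ sym w≡g^j ⟩
        w                              ∎)
      w^r≡1 : w ≢ 0# → w ^ r ≡ 1#
      w^r≡1 w≢0 = *-cancelˡ w≢0 (trans w^p≡w (sym (*-identityʳ w)))
      split : Dec (w ≡ 0#) → ∃ λ i → primeField i ≡ w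
      split (yes w≡0) = zero , sym w≡0
      split (no w≢0) =
        let j , w≡g^j = logarithm w w≢0
            g^jr≡1 = trans (^-* g j r) (trans (cong (_^ r) (sym w≡g^j)) (w^r≡1 w≢0))
        in power j w≡g^j (*-cancelˡ-∣ r (subst (r ℕ.* M ∣_) (ℕ.*-comm j r) (order-divides g-order (j ℕ.* r) g^jr≡1)))

    fixedPoint-difference : ∀ {P x₀ x} → affMap F p P x₀ ≡ x₀ → affMap F p P x ≡ x →
      L (AffParam.a P) (x + - x₀) ≡ x + - x₀
    fixedPoint-difference {P} {x₀} {x} fixed₀ fixed = +-cancelʳ x₀ _ _ (begin
      L (AffParam.a P) (x + - x₀) + x₀   ≡⟨ sym (translate-fixedPoint {P} fixed₀ (x + - x₀)) ⟩
      affMap F p P (x + - x₀ + x₀)       ≡⟨ cong (affMap F p P) (difference x x₀) ⟩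
      affMap F p P x                     ≡⟨ fixed ⟩
      x                                  ≡⟨ sym (difference x x₀) ⟩
      x + - x₀ + x₀                      ∎)

    -- The difference of two fixed points is fixed by the linear part, so it is 0 unless the norm is
    -- 1.
    uniqueFixedPoint : ∀ P → HasFixedPoint (affMap F p P) → N (AffParam.a P) ≢ 1# →
      HasExactlyFixedPoints (affMap F p P) 1
    uniqueFixedPoint P s₀@(x₀ , fixed₀) N≢1 = bijective⇒↔ (λ _ → s₀)
      (λ { {zero} {zero} _ → refl }) λ s → zero , fixed-≡ {f = affMap F p P} (sym (same s))
      where
      same : ∀ (s : ∃ λ x → affMap F p P x ≡ x) → proj₁ s ≡ x₀
      same (x , fixed) with x + - x₀ ≟ 0#
      ... | yes ≡0 = trans (sym (difference x x₀)) (trans (cong (_+ x₀) ≡0) (+-identityˡ x₀))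
      ... | no ≢0 = contradiction (L-fixed⇒N≡1 (fixedPoint-difference {P} fixed₀ fixed) ≢0) N≢1

    -- With a = v^(p−1), the fixed points of L a are the w / v for w in the prime field.
    pFixedPoints : ∀ P → HasFixedPoint (affMap F p P) → N (AffParam.a P) ≡ 1# →
      HasExactlyFixedPoints (affMap F p P) p
    pFixedPoints P (x₀ , fixed₀) Na≡1 =
      let v , v≢0 , a≡v^r = N≡1⇒power (AffParam.a≢0 P) Na≡1
          v⁻¹ , vv⁻¹≡1 = inverse v v≢0
      in parametrise v v≢0 a≡v^r v⁻¹ vv⁻¹≡1
      where
      a = AffParam.a P
      f = affMap F p P
      parametrise : ∀ v → v ≢ 0# → a ≡ v ^ r → ∀ v⁻¹ → v * v⁻¹ ≡ 1# → Fin p ↔ (∃ λ x → f x ≡ x)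
      parametrise v v≢0 a≡v^r v⁻¹ vv⁻¹≡1 = bijective⇒↔ enumerate enumerate-injective enumerate-surjective
        where
        v*v⁻¹* : ∀ w → v * (v⁻¹ * w) ≡ w
        v*v⁻¹* w = trans (sym (*-assoc v v⁻¹ w)) (trans (cong (_* w) vv⁻¹≡1) (*-identityˡ w))
        -- Multiplication by `v` conjugates `L a` to the Frobenius map, whose fixed points form the
        -- prime field.
        v*L : ∀ y → v * L a y ≡ (v * y) ^ p
        v*L y = begin
          v * (a * y ^ p)        ≡⟨ cong (λ c → v * (c * y ^ p)) a≡v^r ⟩
          v * (v ^ r * y ^ p)    ≡⟨ sym (*-assoc v (v ^ r) (y ^ p)) ⟩
          v ^ p * y ^ p          ≡⟨ sym (*-^ v y p) ⟩
          (v * y) ^ p            ∎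
        root : Fin p → Carrier
        root i = v⁻¹ * primeField i
        root-fixed : ∀ i → L a (root i) ≡ root i
        root-fixed i = *-cancelˡ v≢0 (begin
          v * L a (root i)   ≡⟨ v*L (root i) ⟩
          (v * root i) ^ p   ≡⟨ cong (_^ p) (v*v⁻¹* (primeField i)) ⟩
          primeField i ^ p   ≡⟨ primeField-fixed i ⟩
          primeField i       ≡⟨ sym (v*v⁻¹* (primeField i)) ⟩
          v * root i         ∎)
        abstract
          translate-fixed : ∀ i → f (root i + x₀) ≡ root i + x₀
          translate-fixed i = begin
            f (root i + x₀)      ≡⟨ translate-fixedPoint {P} {x₀} fixed₀ (root i) ⟩
            L a (root i) + x₀    ≡⟨ cong (_+ x₀) (root-fixed i) ⟩
            root i + x₀          ∎
        enumerate : Fin p → ∃ λ x → f x ≡ x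
        enumerate i = root i + x₀ , translate-fixed i
        enumerate-injective : Injective _≡_ _≡_ enumerate
        enumerate-injective {i} {j} eq = zeroOrPower-injective h-order {i} {j}
          (*-cancelˡ (inverse≢0 vv⁻¹≡1) (+-cancelʳ x₀ (root i) (root j) (cong proj₁ eq)))
        enumerate-surjective : ∀ s → ∃ λ i → enumerate i ≡ s
        enumerate-surjective (x , fixed) =
          let i , i≡vy = primeField-complete (v * y) vy-fixed in i , recover i i≡vy
          where
          y = x + - x₀
          vy-fixed : (v * y) ^ p ≡ v * y
          vy-fixed = trans (sym (v*L y)) (cong (v *_) (fixedPoint-difference {P} fixed₀ fixed))
          recover : ∀ i → primeField i ≡ v * y → enumerate i ≡ (x , fixed)
          recover i eq = fixed-≡ {f} {enumerate i} {x , fixed}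
            (trans (cong (_+ x₀) (*-cancelˡ v≢0 (trans (v*v⁻¹* (primeField i)) eq))) (difference x x₀))

    -- The classification.

    open Divisors r

    System : AffParam F → Carrier → Carrier
    System = affMap F p

    normalForm : ∀ P → HasFixedPoint (System P) → ∃ λ e → e ∣ r × L (g ^ e) ≅ System P
    normalForm P@(param a a≢0 b) fp = ofPower (logarithm a a≢0)
      where
      ofPower : (∃ λ i → a ≡ g ^ i) → ∃ λ e → e ∣ r × L (g ^ e) ≅ System P
      ofPower (i , a≡g^i) = gcd i r , gcd[m,n]∣n i r , ≅-trans (≅-sym (L-normalForm i))
        (subst (λ c → L c ≅ System P) a≡g^i (linearise P fp))

    -- A relation that carries its evidence: the class of `P` does not depend on how a normal form
    -- was found, since `type-invariant` compares any two.
    data Type (P : AffParam F) : Fin (τ r) ⊎ Fin 1 → Set where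
      fixed : ∀ i → L (g ^ divisor i) ≅ System P → Type P (inj₁ i)
      free  : ¬ HasFixedPoint (System P) → Type P (inj₂ zero)

    L-fixedPoint : ∀ a → HasFixedPoint (L a)
    L-fixedPoint a = 0# , trans (cong (a *_) 0^p) (zeroʳ a)

    typeOf : ∀ P → ∃ (Type P)
    typeOf P = decide (hasFixedPoint? (System P))
      where
      ofNormalForm : (∃ λ e → e ∣ r × L (g ^ e) ≅ System P) → ∃ (Type P)
      ofNormalForm (e , e∣r , equiv) = inj₁ (divisorIndex e∣r) , fixed (divisorIndex e∣r)
        (subst (λ d → L (g ^ d) ≅ System P) (sym (divisor-divisorIndex e∣r)) equiv)
      decide : Dec (HasFixedPoint (System P)) → ∃ (Type P)
      decide (yes fp)  = ofNormalForm (normalForm P fp)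
      decide (no none) = inj₂ zero , free none

    type-complete : ∀ {P Q s} → Type P s → Type Q s → System P ≅ System Q
    type-complete (fixed i P≅) (fixed .i Q≅) = ≅-trans (≅-sym P≅) Q≅
    type-complete {P} {Q} (free noneP) (free noneQ) = fixedPointFree-unique P Q noneP noneQ

    type-invariant : ∀ {P Q s t} → Type P s → Type Q t → System P ≅ System Q → s ≡ t
    type-invariant (fixed i P≅) (fixed j Q≅) P≅Q = cong inj₁ (divisor-injective i j
      (normalForms-≡ (divisor∣ i) (divisor∣ j) (≅-trans P≅ (≅-trans P≅Q (≅-sym Q≅)))))
    type-invariant (fixed i P≅) (free none) P≅Q =
      contradiction (≅-fixedPoint (≅-trans P≅ P≅Q) (L-fixedPoint _)) none
    type-invariant (free none) (fixed j Q≅) P≅Q =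
      contradiction (≅-fixedPoint (≅-trans Q≅ (≅-sym P≅Q)) (L-fixedPoint _)) none
    type-invariant (free _) (free _) _ = refl

    type-realised : ∀ s → ∃ λ P → Type P s
    type-realised (inj₁ i) = param (g ^ divisor i) (^-≢0 g≢0 (divisor i)) 0# ,
      fixed i (≗⇒≅ λ x → sym (+-identityʳ _))
    type-realised (inj₂ zero) = map₂ free fixedPointFree-exists

    join-injective : ∀ m n s t → join m n s ≡ join m n t → s ≡ t
    join-injective m n s t eq = trans (sym (Fin.splitAt-join m n s)) (trans (cong (splitAt m) eq) (Fin.splitAt-join m n t))

    numberOfClasses : HasNumberOfClasses (λ P Q → DynEquiv (System P) (System Q)) (τ r ℕ.+ 1)
    numberOfClasses = cls , cls-surjective , λ P Q → mk⇔
      (λ eq → ≅⇒dynEquiv (type-complete (proj₂ (typeOf P))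
        (subst (Type Q) (sym (join-injective (τ r) 1 _ _ eq)) (proj₂ (typeOf Q)))))
      (λ equiv → cong (join (τ r) 1)
        (type-invariant (proj₂ (typeOf P)) (proj₂ (typeOf Q)) (dynEquiv⇒≅ equiv)))
      where
      cls : AffParam F → Fin (τ r ℕ.+ 1)
      cls P = join (τ r) 1 (proj₁ (typeOf P))
      cls-surjective : Surjective _≡_ _≡_ cls
      cls-surjective i with type-realised (splitAt (τ r) i)
      -- The type chosen by `typeOf P` is not the realised one by computation; invariance under the
      -- identity conjugacy identifies them.
      ... | P , type = P , λ { refl → trans
        (cong (join (τ r) 1) (type-invariant (proj₂ (typeOf P)) type (≗⇒≅ λ _ → refl)))
        (Fin.join-splitAt (τ r) 1 i) }

open import Data.Nat.Base using (_+_; _^_)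

theorem3p7 : (p k : ℕ) → Prime p → 1 ≤ k → (F : FiniteField (p ^ k)) →
    HasNumberOfClasses (λ P Q → DynEquiv (affMap F p P) (affMap F p Q)) (τ (p ∸ 1) + 1)
    × ((∃ λ P → ¬ HasFixedPoint (affMap F p P))
    × (∀ P Q → ¬ HasFixedPoint (affMap F p P) → ¬ HasFixedPoint (affMap F p Q)
    → DynEquiv (affMap F p P) (affMap F p Q)))
    × (∀ P → HasFixedPoint (affMap F p P) →
    (Nm F p k (AffParam.a P) ≡ FiniteField.1# F → HasExactlyFixedPoints (affMap F p P) p)
    × (Nm F p k (AffParam.a P) ≢ FiniteField.1# F → HasExactlyFixedPoints (affMap F p P) 1))
theorem3p7 zero    k p-prime 1≤k F = contradiction p-prime ¬prime[0]
theorem3p7 (suc r) k p-prime 1≤k F = fromPrimitiveRoot primitiveRoot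
  where
  open FieldTheory F
  open Dynamics r k p-prime F
  fromPrimitiveRoot : (∃₂ λ g n → q ≡ suc n × HasOrder g n) → _
  fromPrimitiveRoot (g , n , q≡1+n , g-order) =
    numberOfClasses ,
    (fixedPointFree-exists , λ P Q noneP noneQ → ≅⇒dynEquiv (fixedPointFree-unique P Q noneP noneQ)) ,
    λ P fp → pFixedPoints P fp , uniqueFixedPoint P fp
    where
    g-order′ = subst (HasOrder g) (ℕ.suc-injective (trans (sym q≡1+n) (sym (*-normExp r k)))) g-order
    open PrimitiveRoot g g-order′
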